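{- For every integer $n\ge 1$, $$|\mathcal{S}_n(23;\,1\to 1)| = d_n + d_{n-1} + \sum_{m=1}^{n-1}\sum_{r=0}^{m-1}\binom{m-1}{r}\binom{n-m+r-1}{r}\, r!\; d_{m-1-r},$$ where $d_j$ denotes the $j$-th derangement number.
   Context: $[n]=\{1,\dots,n\}$, and $\mathcal{S}_n$ is the set of permutations $\pi=\pi_1\pi_2\cdots\pi_n$ of $[n]$ in one-line notation. The permutation $\hat\pi$: for $\pi\in\mathcal{S}_n$, $\hat\pi\in\mathcal{S}_n$ is the permutation whose cycle form is obtained from the word $\pi_1\cdots\pi_n$ by inserting a left parenthesis before each left-to-right maximum (an entry larger than all entries to its left) and a right parenthesis immediately before the next left-to-right maximum, or at the end of the word. A cycle $(c_1,c_2,\dots,c_s)$ means $c_1\mapsto c_2\mapsto\cdots\mapsto c_s\mapsto c_1$. Example: if $\pi=2537164$ then $\hat\pi=(2)(53)(7164)$. Arrow patterns: an arrow pattern of size $k$ is a pair $(\nu;H)$ where $\nu=\nu_1\cdots\nu_m$ is a word of distinct positive integers, $H$ is a collection of arrows $b_i\to c_i$, and the set of all integers appearing in $\nu$ or $H$ is $[k]$. A permutation $\pi\in\mathcal{S}_n$ contains $(\nu;H)$ if there are a set $X=\{x_1<x_2<\cdots<x_k\}\subseteq[n]$ and indices $t_1<\cdots<t_m$ such that $\pi_{t_1}\pi_{t_2}\cdots\pi_{t_m}=x_{\nu_1}x_{\nu_2}\cdots x_{\nu_m}$ and $\hat\pi(x_{b_i})=x_{c_i}$ for every arrow $b_i\to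 c_i$ in $H$. Otherwise $\pi$ avoids $(\nu;H)$. $\mathcal{S}_n(\nu;H)$ is the set of permutations in $\mathcal{S}_n$ avoiding $(\nu;H)$. The derangement number $d_j$ is the number of permutations of $[j]$ without fixed points ($d_0=1$, $d_1=0$). -}

module Defs where

open import Data.Bool.Base using (if_then_else_)
open import Data.Fin.Base using (Fin; _<_)
open import Data.Fin.Patterns using (0F; 1F; 2F; 3F; 4F; 5F; 6F)
open import Data.Fin.Properties using (_≟_; _<?_; any?; all?)
open import Data.List.Base using (List; []; _∷_; allFin; applyUpTo; cartesianProductWith; filter; foldr; length)
import Data.List.Relation.Unary.All as List
import Data.List.Relation.Unary.Any as List
open import Data.Nat.Base using (ℕ; zero; suc; _+_; _∸_)
open import Data.Nat.ListAction using (sum)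
open import Data.Product.Base using (∃; ∃-syntax; _×_; _,_; proj₂)
open import Data.Sum.Base using (_⊎_; inj₁; inj₂)
open import Data.Vec.Base as Vec using (Vec; []; _∷_; lookup; tabulate; toList)
open import Data.Vec.Membership.Propositional using (_∈_)
open import Data.Vec.Properties using (≡-dec)
import Data.Vec.Relation.Unary.All as All
import Data.Vec.Relation.Unary.AllPairs as AllPairs
import Data.Vec.Relation.Unary.Any as Any
open import Data.Vec.Relation.Unary.Linked using (Linked; linked?)
open import Data.Vec.Relation.Unary.Unique.Propositional using (Unique)
open import Level using (Level)
open import Relation.Binary.PropositionalEquality using (_≡_; _≢_; refl)
open import Relation.Nullary.Decidable using (Dec; does; yes; no; ¬?; map′; _×-dec_)
open import Relation.Nullary.Negation using (¬_)
open import Relation.Unary using (Pred; Decidable)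

private
  variable
    ℓ : Level
    k m n : ℕ

-- The integer i of [n] = {1,…,n} is represented by the element i − 1 of
-- Fin n; positions in a word are shifted in the same way.

words : ∀ n m → List (Vec (Fin n) m)
words n zero    = [] ∷ []
words n (suc m) = cartesianProductWith _∷_ (allFin n) (words n m)

unique? : Decidable (Unique {A = Fin n} {m})
unique? = AllPairs.allPairs? (λ i j → ¬? (i ≟ j))

-- Sₙ in one-line notation: a word of length n over Fin n is a permutation
-- exactly when its letters are distinct.  Every permutation is listed once.
permutations : ∀ n → List (Vec (Fin n) n)
permutations n = filter unique? (words n n)

-- cutAt left w cuts w before every letter that is larger than all the
-- letters before it in w and all the letters in left.  The first component
-- is the part of w before the first cut.
cutAt : List (Fin n) → List (Fin n) → List (Fin n) × List (List (Fin n))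
cutAt left []      = [] , []
cutAt left (a ∷ w) with List.all? (_<? a) left | cutAt (a ∷ left) w
... | yes _ | c , cs = [] , (a ∷ c) ∷ cs
... | no  _ | c , cs = a ∷ c , cs

-- Nothing is dropped: the first letter of a word is always a left-to-right
-- maximum, so the discarded first component is empty.
cycleForm : List (Fin n) → List (List (Fin n))
cycleForm w = proj₂ (cutAt [] w)

-- With c₁ the first entry of a cycle and c ∷ cs a final segment of it:
-- send each entry of the segment to the next one, and the last one to c₁.
stepIn : Fin n → Fin n → List (Fin n) → Fin n → Fin n
stepIn c₁ c []        x = if does (x ≟ c) then c₁ else x
stepIn c₁ c (c′ ∷ cs) x = if does (x ≟ c) then c′ else stepIn c₁ c′ cs x

applyCycle : List (Fin n) → Fin n → Fin n
applyCycle []       x = x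
applyCycle (c ∷ cs) x = stepIn c c cs x

-- The product of the cycles, which are disjoint when π is a permutation.
hat : Vec (Fin n) n → Vec (Fin n) n
hat π = tabulate (λ x → foldr applyCycle x (cycleForm (toList π)))

-- π = 2537164 gives π̂ = (2)(53)(7164), that is 6257341 in one-line notation.
hat-example : hat (1F ∷ 4F ∷ 2F ∷ 6F ∷ 0F ∷ 5F ∷ 3F ∷ [])
                ≡ (5F ∷ 1F ∷ 4F ∷ 6F ∷ 2F ∷ 3F ∷ 0F ∷ [])
hat-example = refl

record ArrowPattern (k : ℕ) : Set where
  field
    {size}   : ℕ
    ν        : Vec (Fin k) size
    H        : List (Fin k × Fin k)    -- (b , c) is the arrow b → c
    distinct : Unique ν
    covering : ∀ i → (i ∈ ν) ⊎ List.Any (λ (b , c) → i ≡ b ⊎ i ≡ c) H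

module _ (p : ArrowPattern k) where
  open ArrowPattern p

  -- An occurrence of p in π: x lists the elements x₁ < ⋯ < xₖ of X,
  -- and t lists the indices t₁ < ⋯ < tₘ.
  record Occurrence (π : Vec (Fin n) n) (x : Vec (Fin n) k) (t : Vec (Fin n) size) : Set where
    constructor occurrence
    field
      x-increasing : Linked _<_ x
      t-increasing : Linked _<_ t
      word         : Vec.map (lookup π) t ≡ Vec.map (lookup x) ν
      arrows       : List.All (λ (b , c) → lookup (hat π) (lookup x b) ≡ lookup x c) H

  Contains : Vec (Fin n) n → Set
  Contains π = ∃[ x ] ∃[ t ] Occurrence π x t

  Avoids : Vec (Fin n) n → Set
  Avoids π = ¬ Contains π

anyVec? : ∀ m {P : Pred (Vec (Fin n) m) ℓ} → Decidable P → Dec (∃ P)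
anyVec? zero    P? = map′ ([] ,_) (λ { ([] , h) → h }) (P? [])
anyVec? (suc m) P? =
  map′ (λ (i , v , h) → i ∷ v , h) (λ { (i ∷ v , h) → i , v , h })
    (any? (λ i → anyVec? m (λ v → P? (i ∷ v))))

occurrence? : ∀ (p : ArrowPattern k) (π : Vec (Fin n) n) x t → Dec (Occurrence p π x t)
occurrence? p π x t =
  map′ (λ (a , b , c , d) → occurrence a b c d)
       (λ { (occurrence a b c d) → a , b , c , d })
    (linked? _<?_ x ×-dec linked? _<?_ t
      ×-dec ≡-dec _≟_ _ _
      ×-dec List.all? (λ (b , c) → lookup (hat π) (lookup x b) ≟ lookup x c) H)
  where open ArrowPattern p

avoids? : (p : ArrowPattern k) → Decidable (Avoids p {n})
avoids? p π = ¬? (anyVec? _ (λ x → anyVec? _ (occurrence? p π x)))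

-- Sₙ(ν; H)
avoiders : ∀ n → ArrowPattern k → List (Vec (Fin n) n)
avoiders n p = filter (avoids? p) (permutations n)

-- (23; 1 → 1), with the integers 1, 2, 3 shifted to 0, 1, 2 in Fin 3.
pattern23-11 : ArrowPattern 3
pattern23-11 = record
  { ν        = 1F ∷ 2F ∷ []
  ; H        = (0F , 0F) ∷ []
  ; distinct = ((λ ()) All.∷ All.[]) AllPairs.∷ All.[] AllPairs.∷ AllPairs.[]
  ; covering = λ
    { 0F → inj₂ (List.here (inj₁ refl))
    ; 1F → inj₁ (Any.here refl)
    ; 2F → inj₁ (Any.there (Any.here refl))
    }
  }

Derangement : Vec (Fin n) n → Set
Derangement π = ∀ i → lookup π i ≢ i

derangement? : Decidable (Derangement {n})
derangement? π = all? (λ i → ¬? (lookup π i ≟ i))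

d : ℕ → ℕ
d j = length (filter derangement? (permutations j))

-- The sum of f i over a ≤ i ≤ b; it is empty when b < a.
sumFromTo : ℕ → ℕ → (ℕ → ℕ) → ℕ
sumFromTo a b f = sum (applyUpTo (λ i → f (a + i)) (suc b ∸ a))

syntax sumFromTo a b (λ i → e) = ∑[ i from a to b ] e

{-# OPTIONS --safe #-}
module Submission where

-- Let m be the smallest fixed point of π̂.  Then π avoids (23; 1 → 1) if and
-- only if the letters above m form a decreasing subword.  If π̂ has no fixed
-- point, then π is arbitrary, and since π ↦ π̂ is a bijection there are d n such
-- words.  Otherwise m is a left-to-right maximum of π, followed by another one
-- or by the end of the word.  If m = n, then π = A n with A a word on [n-1]
-- whose Â has no fixed point.  If m < n, then the next left-to-right maximum
-- must be n, so π = A m n B, where B consists of a set S of r letters below m,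
-- in any order, shuffled into the decreasing word of the letters strictly
-- between m and n, and A is a word on [m-1] ∖ S whose Â has no fixed point.

open import Defs
open import Data.Bool.Base using (if_then_else_)
open import Data.Empty using (⊥-elim)
open import Data.Fin.Base as Fin using (Fin; zero; suc; toℕ; fromℕ<)
import Data.Fin.Properties as Fin
open import Data.List.Base as List using (List; []; _∷_; _++_; _∷ʳ_; allFin; applyUpTo; filter; foldl; foldr; length; map; take; upTo)
open import Data.List.Membership.Propositional using (_∈_; _∉_)
open import Data.List.Membership.Propositional.Properties
open import Data.List.Properties
  using ( length-map; length-++; length-tabulate; length-applyUpTo; length-upTo; map-++; map-injective; map-upTo; take-map
        ; ++-assoc; ++-identityʳ; ∷-injective; ∷-injectiveˡ; ∷-injectiveʳ; ∷ʳ-injectiveˡ; ∷ʳ-++ )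
open import Data.List.Relation.Binary.Permutation.Propositional.Properties using (∈-resp-↭; ↭-length)
open import Data.List.Relation.Binary.Subset.Propositional using (_⊆_)
open import Data.List.Relation.Ternary.Interleaving.Propositional using (Interleaving; []; consˡ; consʳ; toPermutation)
open import Data.List.Relation.Unary.All as All using (All; []; _∷_)
import Data.List.Relation.Unary.All.Properties as All
open import Data.List.Relation.Unary.AllPairs as AllPairs using (AllPairs; []; _∷_)
import Data.List.Relation.Unary.AllPairs.Properties as AllPairs
open import Data.List.Relation.Unary.Any as Any using (here; there)
import Data.List.Relation.Unary.Any.Properties as AnyP
open import Data.List.Relation.Unary.Unique.Propositional using (Unique)
import Data.List.Relation.Unary.Unique.Propositional.Properties as Unique
open import Data.List.Reverse using (Reverse; []; _∶_∶ʳ_; reverseView)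
open import Data.Nat.Base
open import Data.Nat.Combinatorics using (_C_; nCk+nC[k+1]≡[n+1]C[k+1])
open import Data.Nat.ListAction using (sum)
open import Data.Nat.Properties
open import Data.List.Membership.DecPropositional _≟_ using (_∈?_)
open import Data.Product.Base using (∃; ∃₂; _×_; _,_; proj₁; proj₂; -,_)
open import Data.Sum.Base as Sum using (_⊎_; inj₁; inj₂; [_,_]′)
open import Data.Unit.Base using (⊤)
open import Data.Vec.Base as Vec using (Vec; []; _∷_; toList; fromList; lookup)
import Data.Vec.Properties as Vec
import Data.Vec.Relation.Unary.All.Properties as VecAll
import Data.Vec.Relation.Unary.AllPairs as VecAllPairs
open import Data.Vec.Relation.Unary.Linked using ([-]; _∷_)
import Data.Vec.Relation.Unary.Unique.Propositional as VecUnique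
import Data.Vec.Relation.Unary.Unique.Propositional.Properties as VecUnique
open import Function.Base using (_∘_; id)
open import Relation.Binary.Definitions using (tri<; tri≈; tri>)
open import Relation.Binary.PropositionalEquality
open import Relation.Nullary.Decidable using (Dec; yes; no; does; map′; _×-dec_)
open import Relation.Nullary.Negation using (¬_)
open import Relation.Unary using (Decidable)

-- A fixed point larger than the smallest one `m` only forbids rises among fewer letters, so `m`
-- alone decides avoidance. The prefix `A` is a word over an arbitrary set of letters, where `hat`
-- makes no sense. Fixed points are therefore expressed by `Fix`, through left-to-right maxima. This
-- notion depends only on the relative order of the letters, so a word over any `k` letters behaves
-- like a permutation of `k` letters and `d k` applies. The link with `hat` is `successor`, which
-- reads the images off the word while carrying the maximum so far. Injectivity of `hat` is proved
-- by recovering the word from its end; surjectivity then follows by finiteness. The factor for `B`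
-- is a rising product: `r` distinct letters inserted one at a time into a decreasing word of `l` =
-- n - m - 1 letters give (l+1)(l+2)...(l+r) words, which is C(l+r, r) r!. Letters are shifted down
-- by one, so `T` = n - 1 stands for the letter n.

private
  variable
    A B : Set
    P Q : A → Set
    j k l m n r : ℕ
    x y : A
    xs ys U S R : List A
    v w : List ℕ

-- Counting by duplicate-free lists

record Enumerates (P : A → Set) (xs : List A) : Set where
  constructor enumerates
  field
    unique   : Unique xs
    sound    : x ∈ xs → P x
    complete : P x → x ∈ xs

open Enumerates

Count : (A → Set) → ℕ → Set
Count P k = ∃ λ xs → Enumerates P xs × length xs ≡ k

count-cong : k ≡ l → Count P k → Count P l
count-cong refl c = c

unique-∷ : x ∉ xs → Unique xs → Unique (x ∷ xs)
unique-∷ x∉xs u = All.tabulate (λ { y∈xs refl → x∉xs y∈xs }) ∷ u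

unique-++⁻ : ∀ xs → Unique (xs ++ ys) → Unique xs × Unique ys × (∀ {x} → x ∈ xs → x ∉ ys)
unique-++⁻ []       u       = [] , u , λ ()
unique-++⁻ (x ∷ xs) (a ∷ u) with unique-++⁻ xs u | All.++⁻ xs a
... | uxs , uys , dis | b , c = (b ∷ uxs) , uys , λ
  { (here refl) x∈ys → All.lookup c x∈ys refl
  ; (there x∈xs)     → dis x∈xs }

∈-insert⁺ : ∀ xs → y ∈ xs ++ ys → y ∈ xs ++ x ∷ ys
∈-insert⁺ xs y∈ with ∈-++⁻ xs y∈
... | inj₁ p = ∈-++⁺ˡ p
... | inj₂ q = ∈-++⁺ʳ xs (there q)

∈-insert⁻ : ∀ xs → y ∈ xs ++ x ∷ ys → y ≡ x ⊎ y ∈ xs ++ ys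
∈-insert⁻ xs y∈ with ∈-++⁻ xs y∈
... | inj₁ p         = inj₂ (∈-++⁺ˡ p)
... | inj₂ (here eq) = inj₁ eq
... | inj₂ (there q) = inj₂ (∈-++⁺ʳ xs q)

length-insert : ∀ (xs : List A) {x ys} → length (xs ++ x ∷ ys) ≡ suc (length (xs ++ ys))
length-insert []       = refl
length-insert (_ ∷ xs) = cong suc (length-insert xs)

unique-insert⁺ : ∀ xs → x ∉ xs ++ ys → Unique (xs ++ ys) → Unique (xs ++ x ∷ ys)
unique-insert⁺ []       x∉ u       = unique-∷ x∉ u
unique-insert⁺ (z ∷ xs) x∉ (a ∷ u) =
  unique-∷ (λ z∈ → [ (λ { refl → x∉ (here refl) }) , (λ z∈′ → All.lookup a z∈′ refl) ]′ (∈-insert⁻ xs z∈))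
           (unique-insert⁺ xs (x∉ ∘ there) u)

unique-insert⁻ : ∀ xs → Unique (xs ++ x ∷ ys) → x ∉ xs ++ ys × Unique (xs ++ ys)
unique-insert⁻ []       (a ∷ u) = (λ x∈ → All.lookup a x∈ refl) , u
unique-insert⁻ (z ∷ xs) (a ∷ u) with unique-insert⁻ xs u
... | x∉ , u′ =
  (λ { (here refl) → All.lookup a (∈-++⁺ʳ xs (here refl)) refl
     ; (there x∈)  → x∉ x∈ })
  , unique-∷ (λ z∈ → All.lookup a (∈-insert⁺ xs z∈) refl) u′

unique-⊆-length : Unique xs → xs ⊆ ys → length xs ≤ length ys
unique-⊆-length []              sub = z≤n
unique-⊆-length {xs = x ∷ xs} (a ∷ u) sub with ∈-∃++ (sub (here refl))
... | p , q , refl = ≤-trans (s≤s (unique-⊆-length u sub′)) (≤-reflexive (sym (length-insert p)))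
  where
  sub′ : xs ⊆ p ++ q
  sub′ y∈ with ∈-insert⁻ p (sub (there y∈))
  ... | inj₁ refl = ⊥-elim (All.lookup a y∈ refl)
  ... | inj₂ y∈′  = y∈′

-- Pigeonhole principle: deleting the head of `xs` and one occurrence of it from `ys` preserves the
-- inclusion and the bound on the lengths.
unique-⊆-⊇ : Unique xs → xs ⊆ ys → length ys ≤ length xs → ys ⊆ xs
unique-⊆-⊇ {xs = []}     {ys = []} _ _ _ ()
unique-⊆-⊇ {xs = x ∷ xs} (a ∷ u) sub len {y} y∈ with ∈-∃++ (sub (here refl))
... | p , q , refl with ∈-insert⁻ p y∈
...   | inj₁ refl = here refl
...   | inj₂ y∈′  = there (unique-⊆-⊇ u sub′ (s≤s⁻¹ (subst (_≤ _) (length-insert p) len)) y∈′)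
  where
  sub′ : xs ⊆ p ++ q
  sub′ z∈ with ∈-insert⁻ p (sub (there z∈))
  ... | inj₁ refl = ⊥-elim (All.lookup a z∈ refl)
  ... | inj₂ z∈′  = z∈′

enumerates-length : Enumerates P xs → Enumerates P ys → length xs ≡ length ys
enumerates-length e f = ≤-antisym
  (unique-⊆-length (unique e) (complete f ∘ sound e))
  (unique-⊆-length (unique f) (complete e ∘ sound f))

-- Double counting: the theorem and the derangement count both arise from two enumerations of one
-- class.
count-unique : Count P k → Count P l → k ≡ l
count-unique (_ , e , refl) (_ , f , refl) = enumerates-length e f

InjectiveOn : (A → Set) → (A → B) → Set
InjectiveOn P f = ∀ {x y} → P x → P y → f x ≡ f y → x ≡ y

unique-map : {f : A → B} → InjectiveOn (_∈ xs) f → Unique xs → Unique (map f xs)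
unique-map inj []      = []
unique-map {f = f} inj (a ∷ u) =
  unique-∷ (λ fx∈ → let y , y∈ , eq = ∈-map⁻ f fx∈ in
             All.lookup a y∈ (inj (here refl) (there y∈) eq))
           (unique-map (λ p q → inj (there p) (there q)) u)

count-image : (f : A → B) → Count P k →
              (∀ {x} → P x → Q (f x)) →
              InjectiveOn P f →
              (∀ {y} → Q y → ∃ λ x → P x × f x ≡ y) →
              Count Q k
count-image {Q = Q} f (xs , e , refl) to inj sur = map f xs , record
  { unique   = unique-map (λ p q → inj (sound e p) (sound e q)) (unique e)
  ; sound    = λ y∈ → let x , x∈ , eq = ∈-map⁻ f y∈ in subst Q (sym eq) (to (sound e x∈))
  ; complete = λ q → let x , p , eq = sur q in subst (_∈ _) eq (∈-map⁺ f (complete e p))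
  } , length-map f xs

count-⇔ : (∀ {x} → P x → Q x) → (∀ {x} → Q x → P x) → Count P k → Count Q k
count-⇔ to from c = count-image id c to (λ _ _ → id) (λ q → -, from q , refl)

count-⊎ : (∀ {x} → P x → ¬ Q x) → Count P k → Count Q l → Count (λ x → P x ⊎ Q x) (k + l)
count-⊎ dis (xs , e , refl) (ys , f , refl) = xs ++ ys , record
  { unique   = Unique.++⁺ (unique e) (unique f) (λ (p , q) → dis (sound e p) (sound f q))
  ; sound    = λ x∈ → Sum.map (sound e) (sound f) (∈-++⁻ xs x∈)
  ; complete = λ { (inj₁ p) → ∈-++⁺ˡ (complete e p)
                 ; (inj₂ q) → ∈-++⁺ʳ xs (complete f q) }
  } , length-++ xs

count-⊥ : (∀ {x : A} → ¬ P x) → Count P 0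
count-⊥ ¬p = [] , enumerates [] (λ ()) (⊥-elim ∘ ¬p) , refl

count-singleton : ∀ x → P x → (∀ {y : A} → P y → y ≡ x) → Count P 1
count-singleton x p only =
  x ∷ [] , enumerates ([] ∷ []) (λ { (here refl) → p }) (here ∘ only) , refl

count-filter : (Q? : Decidable Q) → Enumerates P xs →
               Count (λ x → P x × Q x) (length (filter Q? xs))
count-filter Q? e = _ , record
  { unique   = Unique.filter⁺ Q? (unique e)
  ; sound    = λ x∈ → let x∈′ , q = ∈-filter⁻ Q? x∈ in sound e x∈′ , q
  ; complete = λ (p , q) → ∈-filter⁺ Q? (complete e p) q
  } , refl

count-Σ-∈ : {R : A → B → Set} {f : A → ℕ} → ∀ xs → Unique xs →
            (∀ {x} → x ∈ xs → Count (R x) (f x)) →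
            Count (λ (x , y) → x ∈ xs × R x y) (sum (map f xs))
count-Σ-∈ []       _       c = count-⊥ λ ()
count-Σ-∈ {R = R} (x ∷ xs) (a ∷ u) c =
  count-⇔ (λ { (inj₁ (refl , r)) → here refl , r
             ; (inj₂ (x∈ , r))   → there x∈ , r })
          (λ { (here refl , r) → inj₁ (refl , r)
             ; (there x∈ , r)  → inj₂ (x∈ , r) })
    (count-⊎ (λ { (refl , _) (x∈ , _) → All.lookup a x∈ refl })
      (count-image {Q = λ (z , y) → z ≡ x × R x y} (x ,_) (c (here refl)) (refl ,_) (λ { _ _ refl → refl })
        (λ { {_ , y} (refl , r) → y , r , refl }))
      (count-Σ-∈ xs u (c ∘ there)))

count-Σ-< : ∀ n {R : ℕ → B → Set} {f : ℕ → ℕ} →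
            (∀ {i} → i < n → Count (R i) (f i)) →
            Count (λ (i , y) → i < n × R i y) (sum (applyUpTo f n))
count-Σ-< n {f = f} c =
  count-cong (cong sum (map-upTo f n))
    (count-⇔ (λ (i∈ , r) → ∈-upTo⁻ i∈ , r) (λ (i< , r) → ∈-upTo⁺ i< , r)
      (count-Σ-∈ (upTo n) (Unique.upTo⁺ n) (c ∘ ∈-upTo⁻)))

sum-const : ∀ (xs : List A) → sum (map (λ _ → l) xs) ≡ length xs * l
sum-const []       = refl
sum-const (_ ∷ xs) = cong (_ +_) (sum-const xs)

count-× : {R : A → B → Set} → Count P k → (∀ {x} → P x → Count (R x) l) →
          Count (λ (x , y) → P x × R x y) (k * l)
count-× (xs , e , refl) c =
  count-cong (sum-const xs)
    (count-⇔ (λ (x∈ , r) → sound e x∈ , r) (λ (p , r) → complete e p , r)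
      (count-Σ-∈ xs (unique e) (c ∘ sound e)))

-- The fundamental bijection

-- If the letter read last is followed by the word v and the maximum of the
-- letters read so far, which is the head of the current cycle, is M, then π̂
-- maps that letter to next M v.
next : ℕ → List ℕ → ℕ
next M []      = M
next M (a ∷ v) with M <? a
... | yes _ = M
... | no  _ = a

-- π̂ x is successor 0 π x.
successor : ℕ → List ℕ → ℕ → ℕ
successor M []      x = x
successor M (a ∷ v) x with x ≟ a
... | yes _ = next (M ⊔ a) v
... | no  _ = successor (M ⊔ a) v x

successor-head : ∀ M a v → successor M (a ∷ v) a ≡ next (M ⊔ a) v
successor-head M a v with a ≟ a
... | yes _  = refl
... | no a≢a = ⊥-elim (a≢a refl)

successor-tail : ∀ M {a} v {x} → x ≢ a → successor M (a ∷ v) x ≡ successor (M ⊔ a) v x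
successor-tail M {a} v {x} x≢a with x ≟ a
... | yes x≡a = ⊥-elim (x≢a x≡a)
... | no  _   = refl

next-∈ : ∀ M v → next M v ∈ M ∷ v
next-∈ M []      = here refl
next-∈ M (a ∷ v) with M <? a
... | yes _ = here refl
... | no  _ = there (here refl)

∈-⊔ : ∀ M a {v y} → y ∈ (M ⊔ a) ∷ v → y ∈ M ∷ a ∷ v
∈-⊔ M a (there y∈) = there (there y∈)
∈-⊔ M a (here refl) with ⊔-sel M a
... | inj₁ eq = here eq
... | inj₂ eq = there (here eq)

successor-∈ : ∀ M a v {x} → x ∈ a ∷ v → successor M (a ∷ v) x ∈ (M ⊔ a) ∷ v
successor-∈ M a v {x} x∈ with x ≟ a
successor-∈ M a v       x∈          | yes _  = next-∈ (M ⊔ a) v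
successor-∈ M a v       (here x≡a)  | no x≢a = ⊥-elim (x≢a x≡a)
successor-∈ M a (b ∷ v) (there x∈)  | no _   = ∈-⊔ (M ⊔ a) b (successor-∈ (M ⊔ a) b v x∈)

⊔-∉ : ∀ {M b v} → M ∉ b ∷ v → Unique (b ∷ v) → M ⊔ b ∉ v
⊔-∉ {M} {b} M∉ (b≢ ∷ _) with ⊔-sel M b
... | inj₁ eq = λ m∈ → M∉ (there (subst (_∈ _) eq m∈))
... | inj₂ eq = λ m∈ → All.lookup b≢ m∈ (sym eq)

-- Write `v` as `b` followed by a rest. By `successor-∈` every image lies in that rest or is
-- `M ⊔ b`. If `M < b`, then `next` is `M`, which is neither; otherwise it is `b`, while `M ⊔ b` is
-- `M`.
successor-≢-next : ∀ M v {x} → M ∉ v → Unique v → x ∈ v → successor M v x ≢ next M v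
successor-≢-next M (b ∷ v) M∉ (b≢ ∷ u) x∈ eq with successor-∈ M b v x∈ | M <? b
... | s∈ | yes M<b rewrite m≤n⇒m⊔n≡n (<⇒≤ M<b) = M∉ (subst (_∈ _) eq s∈)
... | s∈ | no M≮b rewrite m≥n⇒m⊔n≡m (≮⇒≥ M≮b) with subst (_∈ _) eq s∈
...   | here b≡M = M∉ (here (sym b≡M))
...   | there b∈ = All.lookup b≢ b∈ refl

-- The invariant is that the running maximum does not recur among the unread letters. The image of
-- `a` is then separated from all later images by `successor-≢-next`.
successor-injective : ∀ M a v {x y} → M ⊔ a ∉ v → Unique (a ∷ v) → x ∈ a ∷ v → y ∈ a ∷ v →
                 successor M (a ∷ v) x ≡ successor M (a ∷ v) y → x ≡ y
successor-injective M a v {x} {y} M∉ (a≢ ∷ u) x∈ y∈ eq with x ≟ a | y ≟ a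
successor-injective M a v M∉ (_ ∷ u) x∈ y∈ eq | yes p | yes q = trans p (sym q)
successor-injective M a v M∉ (_ ∷ u) x∈ (here q) eq | yes p | no ¬q = ⊥-elim (¬q q)
successor-injective M a v M∉ (_ ∷ u) x∈ (there y∈) eq | yes p | no ¬q =
  ⊥-elim (successor-≢-next (M ⊔ a) v M∉ u y∈ (sym eq))
successor-injective M a v M∉ (_ ∷ u) (here p) y∈ eq | no ¬p | _ = ⊥-elim (¬p p)
successor-injective M a v M∉ (_ ∷ u) (there x∈) y∈ eq | no ¬p | yes q =
  ⊥-elim (successor-≢-next (M ⊔ a) v M∉ u x∈ eq)
successor-injective M a v M∉ (_ ∷ u) (there x∈) (here q) eq | no ¬p | no ¬q = ⊥-elim (¬q q)
successor-injective M a (b ∷ v) M∉ (_ ∷ u) (there x∈) (there y∈) eq | no ¬p | no ¬q =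
  successor-injective (M ⊔ a) b v (⊔-∉ M∉ u) u x∈ y∈ eq

-- The starting value 0 is harmless although 0 is also a letter: `0 ⊔ a` is `a`, so it is forgotten
-- at the first letter.
successor₀-injective : ∀ {w x y} → Unique w → x ∈ w → y ∈ w → successor 0 w x ≡ successor 0 w y → x ≡ y
successor₀-injective {a ∷ v} u@(a≢ ∷ _) =
  successor-injective 0 a v (λ a∈ → All.lookup a≢ a∈ refl) u

maximum : ℕ → List ℕ → ℕ
maximum = foldl _⊔_

maximum-lub : ∀ {M k} u → M ≤ k → All (_≤ k) u → maximum M u ≤ k
maximum-lub []      M≤ []       = M≤
maximum-lub (a ∷ u) M≤ (a≤ ∷ h) = maximum-lub u (⊔-lub M≤ a≤) h

maximum-ub : ∀ {M x} u → x ∈ M ∷ u → x ≤ maximum M u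
maximum-ub []      (here refl)          = ≤-refl
maximum-ub {M} (a ∷ u) (here refl)          = ≤-trans (m≤m⊔n M a) (maximum-ub u (here refl))
maximum-ub {M} (a ∷ u) (there (here refl))  = ≤-trans (m≤n⊔m M a) (maximum-ub u (here refl))
maximum-ub (a ∷ u) (there (there x∈))   = maximum-ub u (there x∈)

maximum-mono : ∀ {M u u′} → u ⊆ u′ → maximum M u ≤ maximum M u′
maximum-mono {u = u} {u′} u⊆ = maximum-lub u (maximum-ub u′ (here refl))
  (All.tabulate (λ x∈ → maximum-ub u′ (there (u⊆ x∈))))

successor-split : ∀ M u a v → a ∉ u → successor M (u ++ a ∷ v) a ≡ next (maximum M (u ∷ʳ a)) v
successor-split M []      a v a∉ = successor-head M a v
successor-split M (b ∷ u) a v a∉ =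
  trans (successor-tail M (u ++ a ∷ v) (a∉ ∘ here)) (successor-split (M ⊔ b) u a v (a∉ ∘ there))

-- The two prefixes have the same letters, hence the same maximum, so `a` in the first word and `a′`
-- in the second have the same image. As the two successor maps agree, injectivity of the first
-- identifies the letters.
last-determined : ∀ us {a} us′ {a′ v} → Unique (us ++ a ∷ v) → Unique (us′ ++ a′ ∷ v) →
  (∀ {x} → x ∈ us ++ a ∷ v → successor 0 (us ++ a ∷ v) x ≡ successor 0 (us′ ++ a′ ∷ v) x) →
  us ∷ʳ a ⊆ us′ ∷ʳ a′ → us′ ∷ʳ a′ ⊆ us ∷ʳ a → a ≡ a′
last-determined us {a} us′ {a′} {v} U U′ s≗ sub sup =
  successor₀-injective U (∈-++⁺ʳ us (here refl)) a′∈ (begin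
    successor 0 (us ++ a ∷ v) a         ≡⟨ successor-split 0 us a v (proj₁ (unique-insert⁻ us U) ∘ ∈-++⁺ˡ) ⟩
    next (maximum 0 (us ∷ʳ a)) v   ≡⟨ cong (λ M → next M v)
                                        (≤-antisym (maximum-mono sub) (maximum-mono sup)) ⟩
    next (maximum 0 (us′ ∷ʳ a′)) v ≡⟨ successor-split 0 us′ a′ v (proj₁ (unique-insert⁻ us′ U′) ∘ ∈-++⁺ˡ) ⟨
    successor 0 (us′ ++ a′ ∷ v) a′      ≡⟨ s≗ a′∈ ⟨
    successor 0 (us ++ a ∷ v) a′        ∎)
  where
  open ≡-Reasoning
  a′∈ : a′ ∈ us ++ a ∷ v
  a′∈ = subst (a′ ∈_) (∷ʳ-++ us a v) (∈-++⁺ˡ (sup (∈-++⁺ʳ us′ (here refl))))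

∷ʳ-⊆⁻ : ∀ us us′ {a : ℕ} {v} → Unique (us ++ a ∷ v) → us ∷ʳ a ⊆ us′ ∷ʳ a → us ⊆ us′
∷ʳ-⊆⁻ us us′ U sub x∈ with ∈-++⁻ us′ (sub (∈-++⁺ˡ x∈))
... | inj₁ x∈′        = x∈′
... | inj₂ (here refl) = ⊥-elim (proj₁ (unique-insert⁻ us U) (∈-++⁺ˡ x∈))

-- The word is read off from right to left: if the prefix u is followed by v,
-- then successor maps the last letter of u to next (maximum 0 u) v, which depends
-- only on v and on the set of letters of u.
successor-determines-prefix : ∀ {w w′ u u′ v} → Unique w → Unique w′ →
  (∀ {x} → x ∈ w → successor 0 w x ≡ successor 0 w′ x) →
  Reverse u → Reverse u′ → w ≡ u ++ v → w′ ≡ u′ ++ v → u ⊆ u′ → u′ ⊆ u → u ≡ u′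
successor-determines-prefix U U′ s≗ []            []               _ _ _ _ = refl
successor-determines-prefix U U′ s≗ []            (us′ ∶ _ ∶ʳ a′) _ _ _ sup with sup (∈-++⁺ʳ us′ (here refl))
... | ()
successor-determines-prefix U U′ s≗ (us ∶ _ ∶ʳ a) []               _ _ sub _ with sub (∈-++⁺ʳ us (here refl))
... | ()
successor-determines-prefix {v = v} U U′ s≗ (us ∶ r ∶ʳ a) (us′ ∶ r′ ∶ʳ a′) eq eq′ sub sup
  with refl ← trans eq (∷ʳ-++ us a v) | refl ← trans eq′ (∷ʳ-++ us′ a′ v)
  with refl ← last-determined us us′ U U′ s≗ sub sup
  = cong (_∷ʳ a) (successor-determines-prefix U U′ s≗ r r′ refl refl
                    (∷ʳ-⊆⁻ us us′ U sub) (∷ʳ-⊆⁻ us′ us U′ sup))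

successor-determines : ∀ {w w′} → Unique w → Unique w′ → w ⊆ w′ → w′ ⊆ w →
  (∀ {x} → x ∈ w → successor 0 w x ≡ successor 0 w′ x) → w ≡ w′
successor-determines {w} {w′} U U′ sub sup s≗ =
  successor-determines-prefix {v = []} U U′ s≗ (reverseView w) (reverseView w′)
    (sym (++-identityʳ w)) (sym (++-identityʳ w′)) sub sup

-- The letter x forms a cycle of its own.
Fix : List ℕ → ℕ → Set
Fix w x = ∃₂ λ u v → w ≡ u ++ x ∷ v × All (_< x) u × All (x <_) (take 1 v)

NoFix : List ℕ → Set
NoFix w = ∀ x → ¬ Fix w x

fix-∈ : ∀ {w x} → Fix w x → x ∈ w
fix-∈ (u , _ , refl , _) = ∈-++⁺ʳ u (here refl)

maximum-∷ʳ : ∀ {M x} u → M ≤ x → All (_≤ x) u → maximum M (u ∷ʳ x) ≡ x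
maximum-∷ʳ {x = x} u M≤x h = ≤-antisym
  (maximum-lub (u ∷ʳ x) M≤x (All.∷ʳ⁺ h ≤-refl))
  (maximum-ub (u ∷ʳ x) (there (∈-++⁺ʳ u (here refl))))

fix⇒successor : ∀ {w x} → Fix w x → successor 0 w x ≡ x
fix⇒successor {x = x} (u , v , refl , u< , v>) =
  trans (successor-split 0 u x v (λ x∈ → <-irrefl refl (All.lookup u< x∈)))
    (trans (cong (λ M → next M v) (maximum-∷ʳ u z≤n (All.map <⇒≤ u<))) (next-fix v v>))
  where
  next-fix : ∀ v → All (x <_) (take 1 v) → next x v ≡ x
  next-fix []      _ = refl
  next-fix (b ∷ v) (x<b ∷ _) with x <? b
  ... | yes _  = refl
  ... | no x≮b = ⊥-elim (x≮b x<b)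

-- Since `x` does not recur in `v`, the value `next M v` can be `x` only by being the cycle head
-- `M`. So `x` is the maximum of its prefix, and `v` is empty or opens a new cycle.
successor⇒fix : ∀ {w x} → Unique w → x ∈ w → successor 0 w x ≡ x → Fix w x
successor⇒fix {x = x} U x∈ eq with ∈-∃++ x∈
... | u , v , refl with unique-insert⁻ u U
...   | x∉ , _ = u , v , refl , All.tabulate u< , proj₂ max≡x,v>
  where
  M = maximum 0 (u ∷ʳ x)

  next-fix : ∀ v → x ∉ v → next M v ≡ x → M ≡ x × All (M <_) (take 1 v)
  next-fix []      _   eq = eq , []
  next-fix (b ∷ v) x∉v eq with M <? b
  ... | yes M<b = eq , (M<b ∷ [])
  ... | no  _   = ⊥-elim (x∉v (here (sym eq)))

  max≡x,v> : M ≡ x × All (x <_) (take 1 v)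
  max≡x,v> with next-fix v (x∉ ∘ ∈-++⁺ʳ u) (trans (sym (successor-split 0 u x v (x∉ ∘ ∈-++⁺ˡ))) eq)
  ... | M≡x , v> = M≡x , subst (λ y → All (y <_) _) M≡x v>

  u< : ∀ {y} → y ∈ u → y < x
  u< y∈ = ≤∧≢⇒< (subst (_ ≤_) (proj₁ max≡x,v>) (maximum-ub (u ∷ʳ x) (there (∈-++⁺ˡ y∈))))
                 (λ { refl → x∉ (∈-++⁺ˡ y∈) })

-- Agreement of `hat` with `successor`

word : ∀ {m} → Vec (Fin n) m → List ℕ
word π = map toℕ (toList π)

if-yes : ∀ {P A : Set} {a b : A} (p : Dec P) → P → (if does p then a else b) ≡ a
if-yes (yes _) _ = refl
if-yes (no ¬p) p = ⊥-elim (¬p p)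

if-no : ∀ {P A : Set} {a b : A} (p : Dec P) → ¬ P → (if does p then a else b) ≡ b
if-no (yes p) ¬p = ⊥-elim (¬p p)
if-no (no _)  _  = refl

stepIn-∉ : ∀ {b : Fin n} c₁ c cs → b ∉ c ∷ cs → stepIn c₁ c cs b ≡ b
stepIn-∉ {b = b} c₁ c []        b∉ = if-no (b Fin.≟ c) (b∉ ∘ here)
stepIn-∉ {b = b} c₁ c (c′ ∷ cs) b∉ =
  trans (if-no (b Fin.≟ c) (b∉ ∘ here)) (stepIn-∉ c₁ c′ cs (b∉ ∘ there))

stepIn-∉⁻ : ∀ {b x : Fin n} c₁ c cs → b ≢ c₁ → b ∉ cs → stepIn c₁ c cs x ≡ b → x ≡ b
stepIn-∉⁻ {x = x} c₁ c [] b≢ b∉ eq with x Fin.≟ c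
... | yes _ = ⊥-elim (b≢ (sym eq))
... | no  _ = eq
stepIn-∉⁻ {x = x} c₁ c (c′ ∷ cs) b≢ b∉ eq with x Fin.≟ c
... | yes _ = ⊥-elim (b∉ (here (sym eq)))
... | no  _ = stepIn-∉⁻ c₁ c′ cs b≢ (b∉ ∘ there) eq

applyCycles-∉ : ∀ {b : Fin n} {cs} → All (b ∉_) cs → foldr applyCycle b cs ≡ b
applyCycles-∉ []                      = refl
applyCycles-∉ {cs = [] ∷ _} (_ ∷ h)   = applyCycles-∉ h
applyCycles-∉ {cs = (c ∷ c′) ∷ cs} (b∉ ∷ h) =
  trans (cong (stepIn c c c′) (applyCycles-∉ h)) (stepIn-∉ c c c′ b∉)

-- `foldr` applies the last cycle first, so an earlier cycle tests the image of `x` under the later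
-- ones instead of `x` itself. This converse shows that such a test against `b` succeeds only for
-- `x ≡ b`.
applyCycles-∉⁻ : ∀ {b x : Fin n} {cs} → All (b ∉_) cs → foldr applyCycle x cs ≡ b → x ≡ b
applyCycles-∉⁻ []                    eq = eq
applyCycles-∉⁻ {cs = [] ∷ _} (_ ∷ h) eq = applyCycles-∉⁻ h eq
applyCycles-∉⁻ {cs = (c ∷ c′) ∷ cs} (b∉ ∷ h) eq =
  applyCycles-∉⁻ h (stepIn-∉⁻ c c c′ (b∉ ∘ here) (b∉ ∘ there) eq)

cutAt-∉ : ∀ {b : Fin n} left w → b ∉ w → b ∉ proj₁ (cutAt left w) × All (b ∉_) (proj₂ (cutAt left w))
cutAt-∉ left []      b∉ = (λ ()) , []
cutAt-∉ left (a ∷ w) b∉ with All.all? (Fin._<? a) left | cutAt (a ∷ left) w | cutAt-∉ (a ∷ left) w (b∉ ∘ there)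
... | yes _ | c , cs | b∉c , h = (λ ()) , (λ { (here eq) → b∉ (here eq) ; (there b∈) → b∉c b∈ }) ∷ h
... | no  _ | c , cs | b∉c , h = (λ { (here eq) → b∉ (here eq) ; (there b∈) → b∉c b∈ }) , h

successor-cons : ∀ M (a : Fin n) v x {M′ z} → M ⊔ toℕ a ≡ M′ →
  (x ≡ a → z ≡ next M′ v) × (x ≢ a → z ≡ successor M′ v (toℕ x)) → z ≡ successor M (toℕ a ∷ v) (toℕ x)
successor-cons M a v x refl (head , tail) with x Fin.≟ a
... | yes refl = trans (head refl) (sym (successor-head M (toℕ a) v))
... | no  x≢a  = trans (tail x≢a) (sym (successor-tail M v (x≢a ∘ Fin.toℕ-injective)))

-- c₁ is the head of the current cycle, hence the maximum of the letters read
-- so far, and b is the letter read last.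
stepIn-successor : ∀ left (c₁ b : Fin n) v x → c₁ ∈ left → All (Fin._≤ c₁) left → Unique (b ∷ v) →
  let z = stepIn c₁ b (proj₁ (cutAt left v)) (foldr applyCycle x (proj₂ (cutAt left v))) in
  (x ≡ b → toℕ z ≡ next (toℕ c₁) (map toℕ v)) ×
  (x ≢ b → toℕ z ≡ successor (toℕ c₁) (map toℕ v) (toℕ x))
stepIn-successor left c₁ b [] x c₁∈ ≤c₁ U =
  (λ x≡b → cong toℕ (if-yes (x Fin.≟ b) x≡b)) , (λ x≢b → cong toℕ (if-no (x Fin.≟ b) x≢b))
stepIn-successor left c₁ b (a ∷ v) x c₁∈ ≤c₁ (b≢ ∷ U)
  with All.all? (Fin._<? a) left
     | cutAt (a ∷ left) v
     | stepIn-successor (a ∷ left) a a v x (here refl)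
     | stepIn-successor (a ∷ left) c₁ a v x (there c₁∈)
     | cutAt-∉ {b = b} (a ∷ left) v (λ b∈ → All.lookup b≢ (there b∈) refl)
     | toℕ c₁ <? toℕ a
-- `c₁` belongs to `left` and bounds it, so the test in `cutAt` agrees with `c₁ <? a`, and the two
-- mixed cases are void. Of the two induction hypotheses, the one with head `a` serves when `a`
-- opens a cycle, the one with head `c₁` when it does not.
... | yes <a | c , cs | ih | _ | b∉c , b∉cs | no c₁≮a = ⊥-elim (c₁≮a (All.lookup <a c₁∈))
... | no ≮a  | c , cs | _ | ih | b∉c , b∉cs | yes c₁<a = ⊥-elim (≮a (All.map (λ y≤ → ≤-<-trans y≤ c₁<a) ≤c₁))
... | yes <a | c , cs | ih | _ | b∉c , b∉cs | yes c₁<a = p , q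
  where
  z = stepIn a a c (foldr applyCycle x cs)

  b≢a : b ≢ a
  b≢a = All.lookup b≢ (here refl)

  ih′ : (x ≡ a → toℕ z ≡ next (toℕ a) (map toℕ v)) × (x ≢ a → toℕ z ≡ successor (toℕ a) (map toℕ v) (toℕ x))
  ih′ = ih (≤-refl ∷ All.map <⇒≤ <a) U

  p : x ≡ b → toℕ (if does (z Fin.≟ b) then c₁ else z) ≡ toℕ c₁
  p refl = cong toℕ (if-yes (z Fin.≟ b)
    (trans (cong (stepIn a a c) (applyCycles-∉ b∉cs))
           (stepIn-∉ a a c λ { (here eq) → b≢a eq ; (there b∈) → b∉c b∈ })))

  q : x ≢ b → toℕ (if does (z Fin.≟ b) then c₁ else z) ≡ successor (toℕ c₁) (map toℕ (a ∷ v)) (toℕ x)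
  q x≢b = trans
    (cong toℕ (if-no (z Fin.≟ b) (x≢b ∘ applyCycles-∉⁻ b∉cs ∘ stepIn-∉⁻ a a c b≢a b∉c)))
    (successor-cons (toℕ c₁) a (map toℕ v) x (m≤n⇒m⊔n≡n (<⇒≤ c₁<a)) ih′)
... | no ≮a  | c , cs | _ | ih | b∉c , b∉cs | no c₁≮a = p , q
  where
  z = foldr applyCycle x cs

  p : x ≡ b → toℕ (if does (z Fin.≟ b) then a else stepIn c₁ a c z) ≡ toℕ a
  p refl = cong toℕ (if-yes (z Fin.≟ b) (applyCycles-∉ b∉cs))

  q : x ≢ b → toℕ (if does (z Fin.≟ b) then a else stepIn c₁ a c z) ≡ successor (toℕ c₁) (map toℕ (a ∷ v)) (toℕ x)
  q x≢b = trans
    (cong toℕ (if-no (z Fin.≟ b) (x≢b ∘ applyCycles-∉⁻ b∉cs)))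
    (successor-cons (toℕ c₁) a (map toℕ v) x (m≥n⇒m⊔n≡m (≮⇒≥ c₁≮a)) (ih (≮⇒≥ c₁≮a ∷ ≤c₁) U))

-- The bijection `hat` and the derangement numbers

Permutation : Vec (Fin n) n → Set
Permutation = VecUnique.Unique

applyCycles-successor : ∀ (w : List (Fin n)) → Unique w → ∀ x →
  toℕ (foldr applyCycle x (cycleForm w)) ≡ successor 0 (map toℕ w) (toℕ x)
applyCycles-successor []      U x = refl
applyCycles-successor (a ∷ v) U x =
  successor-cons 0 a (map toℕ v) x refl (stepIn-successor (a ∷ []) a a v x (here refl) (≤-refl ∷ []) U)

toList-unique : ∀ {A : Set} {m} {v : Vec A m} → VecUnique.Unique v → Unique (toList v)
toList-unique VecAllPairs.[]      = []
toList-unique (a VecAllPairs.∷ u) = VecAll.toList⁺ a ∷ toList-unique u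

hat-successor : ∀ {π : Vec (Fin n) n} → Permutation π → ∀ x →
  toℕ (lookup (hat π) x) ≡ successor 0 (word π) (toℕ x)
hat-successor {π = π} U x =
  trans (cong toℕ (Vec.lookup∘tabulate _ x)) (applyCycles-successor (toList π) (toList-unique U) x)

toList-unique⁻ : {v : Vec A m} → Unique (toList v) → VecUnique.Unique v
toList-unique⁻ {v = []}    _       = VecAllPairs.[]
toList-unique⁻ {v = _ ∷ _} (a ∷ u) = VecAll.toList⁻ a VecAllPairs.∷ toList-unique⁻ u

words-enumerates : ∀ n m → Enumerates (λ _ → ⊤) (words n m)
words-enumerates n m = enumerates (uniq m) _ (λ _ → mem _)
  where
  uniq : ∀ m → Unique (words n m)
  uniq zero    = [] ∷ []
  uniq (suc m) = Unique.cartesianProductWith⁺ _∷_ Vec.∷-injective (Unique.allFin⁺ n) (uniq m)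

  mem : ∀ {m} v → v ∈ words n m
  mem []      = here refl
  mem (i ∷ v) = ∈-cartesianProductWith⁺ _∷_ (∈-allFin i) (mem v)

permutations-enumerates : ∀ n → Enumerates Permutation (permutations n)
permutations-enumerates n with words-enumerates n n
... | e = enumerates (Unique.filter⁺ unique? (unique e))
                     (proj₂ ∘ ∈-filter⁻ unique? {xs = words n n})
                     (∈-filter⁺ unique? (complete e _))

permutation-∈ : {π : Vec (Fin n) n} → Permutation π → ∀ i → i ∈ toList π
permutation-∈ {n} {π} U i = unique-⊆-⊇ (toList-unique U) (λ _ → ∈-allFin _)
  (≤-reflexive (trans (length-tabulate id) (sym (Vec.length-toList π)))) (∈-allFin i)

word-∈ : {π : Vec (Fin n) n} → Permutation π → ∀ i → toℕ i ∈ word π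
word-∈ U i = ∈-map⁺ toℕ (permutation-∈ U i)

word-unique : {π : Vec (Fin n) n} → Permutation π → Unique (word π)
word-unique U = Unique.map⁺ Fin.toℕ-injective (toList-unique U)

toList-injective : {u v : Vec A m} → toList u ≡ toList v → u ≡ v
toList-injective {u = u} {v} eq = trans (sym (Vec.cast-is-id refl u)) (Vec.toList-injective refl u v eq)

hat-permutation : {π : Vec (Fin n) n} → Permutation π → Permutation (hat π)
hat-permutation {π = π} U = VecUnique.tabulate⁺ λ {i} {j} eq → Fin.toℕ-injective
  (successor₀-injective (word-unique U) (word-∈ U i) (word-∈ U j)
    (trans (sym (applyCycles-successor (toList π) (toList-unique U) i))
      (trans (cong toℕ eq) (applyCycles-successor (toList π) (toList-unique U) j))))

hat-injective : InjectiveOn (Permutation {n}) hat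
hat-injective {x = π} {y = ρ} U V eq =
  toList-injective (map-injective Fin.toℕ-injective
    (successor-determines (word-unique U) (word-unique V) (sub V) (sub U) same))
  where
  sub : ∀ {σ τ : Vec (Fin _) _} → Permutation τ → word σ ⊆ word τ
  sub W x∈ with ∈-map⁻ toℕ x∈
  ... | i , _ , refl = word-∈ W i

  same : ∀ {x} → x ∈ word π → successor 0 (word π) x ≡ successor 0 (word ρ) x
  same x∈ with ∈-map⁻ toℕ x∈
  ... | i , _ , refl = trans (sym (hat-successor U i))
    (trans (cong (λ σ → toℕ (lookup σ i)) eq) (hat-successor V i))

-- The images under `hat` form a duplicate-free list of permutations as long as the list of all of
-- them, so the pigeonhole principle `unique-⊆-⊇` applies.
hat-surjective : {σ : Vec (Fin n) n} → Permutation σ → ∃ λ π → Permutation π × hat π ≡ σ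
hat-surjective {n} U with permutations-enumerates n
... | e with ∈-map⁻ hat (unique-⊆-⊇
              (unique-map (λ p q → hat-injective (sound e p) (sound e q)) (unique e))
              hat-⊆ (≤-reflexive (sym (length-map hat (permutations n)))) (complete e U))
  where
  hat-⊆ : map hat (permutations n) ⊆ permutations n
  hat-⊆ σ∈ with ∈-map⁻ hat σ∈
  ... | π , π∈ , refl = complete e (hat-permutation (sound e π∈))
... | π , π∈ , eq = π , sound e π∈ , sym eq

noFix⇒derangement : {π : Vec (Fin n) n} → Permutation π → NoFix (word π) → Derangement (hat π)
noFix⇒derangement U nf i eq =
  nf _ (successor⇒fix (word-unique U) (word-∈ U i) (trans (sym (hat-successor U i)) (cong toℕ eq)))

derangement⇒noFix : {π : Vec (Fin n) n} → Permutation π → Derangement (hat π) → NoFix (word π)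
derangement⇒noFix U der _ fix with ∈-map⁻ toℕ (fix-∈ fix)
... | i , _ , refl = der i (Fin.toℕ-injective (trans (hat-successor U i) (fix⇒successor fix)))

-- `hat` carries these words bijectively onto the derangements.
count-noFix-permutations : ∀ n → Count (λ π → Permutation {n} π × NoFix (word π)) (d n)
count-noFix-permutations n = count-cong (count-unique image (count-filter derangement? e))
  (count-⇔ (λ (U , der) → U , derangement⇒noFix U der)
           (λ (U , nf) → U , noFix⇒derangement U nf) source)
  where
  e = permutations-enumerates n
  source = count-filter (derangement? ∘ hat) e
  image : Count (λ σ → Permutation σ × Derangement σ) _
  image = count-image hat source
    (λ (U , der) → hat-permutation U , der)
    (λ (U , _) (V , _) → hat-injective U V)
    (λ { (U , der) → let π , V , eq = hat-surjective U in
           π , (V , subst Derangement (sym eq) der) , eq })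

-- Words over arbitrary sets of letters

map-preimage : {B : Set} {f : A → B} (w : List B) → (∀ {x} → x ∈ w → ∃ λ i → f i ≡ x) → ∃ λ z → map f z ≡ w
map-preimage []      pre = [] , refl
map-preimage (x ∷ w) pre with pre (here refl) | map-preimage w (pre ∘ there)
... | i , refl | z , refl = i ∷ z , refl

list⇒vec : (z : List A) → length z ≡ n → ∃ λ (v : Vec A n) → toList v ≡ z
list⇒vec z refl = fromList z , Vec.toList∘fromList z

-- Here `Enumerates P w` says that `w` is a permutation of the set of letters `P`, which `f` labels
-- bijectively by `Fin n`. The labelling is `toℕ` for the avoiders and `List.lookup R` for words
-- over a set `R`.
count-words : {P : ℕ → Set} {Q : Vec (Fin n) n → Set} {R : List ℕ → Set} (f : Fin n → ℕ) →
  (∀ {i j} → f i ≡ f j → i ≡ j) → (∀ i → P (f i)) → (∀ {x} → P x → ∃ λ i → f i ≡ x) →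
  (∀ {π} → Permutation π → Q π → R (map f (toList π))) →
  (∀ {π} → Permutation π → R (map f (toList π)) → Q π) →
  Count (λ π → Permutation π × Q π) k → Count (λ w → Enumerates P w × R w) k
count-words {n} {P = P} {Q} {R} f inj P-f f-sur Q⇒R R⇒Q c = count-image (λ π → map f (toList π)) c to
  (λ _ _ eq → toList-injective (map-injective inj eq)) from
  where
  enum : ∀ {π} → Permutation π → Enumerates P (map f (toList π))
  enum U = enumerates (Unique.map⁺ inj (toList-unique U))
    (λ x∈ → let i , _ , eq = ∈-map⁻ f x∈ in subst P (sym eq) (P-f i))
    (λ p → let i , eq = f-sur p in subst (_∈ _) eq (∈-map⁺ f (permutation-∈ U i)))

  to : ∀ {π} → Permutation π × Q π → Enumerates P (map f (toList π)) × R (map f (toList π))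
  to (U , q) = enum U , Q⇒R U q

  enum-allFin : Enumerates P (map f (allFin n))
  enum-allFin = enumerates (Unique.map⁺ inj (Unique.allFin⁺ n))
    (λ x∈ → let i , _ , eq = ∈-map⁻ f x∈ in subst P (sym eq) (P-f i))
    (λ p → let i , eq = f-sur p in subst (_∈ _) eq (∈-map⁺ f (∈-allFin i)))

  from : ∀ {w} → Enumerates P w × R w → ∃ λ π → (Permutation π × Q π) × map f (toList π) ≡ w
  from {w} (e , r) with map-preimage w (f-sur ∘ sound e)
  -- The length is `n` because `w` and `map f (allFin n)` enumerate the same letters.
  ... | z , refl with list⇒vec {n = n} z
    (trans (sym (length-map f z)) (trans (enumerates-length e enum-allFin)
      (trans (length-map f (allFin n)) (length-tabulate id))))
  ... | π , refl = π , (perm , R⇒Q perm r) , refl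
    where
    perm : Permutation π
    perm = toList-unique⁻ (Unique.map⁻ (unique e))

map-split : {B : Set} (f : A → B) → ∀ z u {x v} → map f z ≡ u ++ x ∷ v →
  ∃₂ λ z₁ z₂ → ∃ λ i → z ≡ z₁ ++ i ∷ z₂ × u ≡ map f z₁ × x ≡ f i × v ≡ map f z₂
map-split f (i ∷ z) []      refl = [] , z , i , refl , refl , refl , refl
map-split f (j ∷ z) (y ∷ u) eq with refl ← ∷-injectiveˡ eq
  with map-split f z u (∷-injectiveʳ eq)
... | z₁ , z₂ , i , refl , refl , refl , refl = j ∷ z₁ , z₂ , i , refl , refl , refl , refl

noFix-map : {f g : A → ℕ} → (∀ {i j} → f i < f j → g i < g j) → ∀ z → NoFix (map g z) → NoFix (map f z)
noFix-map {f = f} {g} f⇒g z nf _ (u , v , eq , u< , v>) with map-split f z u eq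
... | z₁ , z₂ , i , refl , refl , refl , refl =
  nf _ (map g z₁ , map g z₂ , map-++ g z₁ (i ∷ z₂)
     , All.map⁺ (All.map f⇒g (All.map⁻ u<))
     , subst (All _) (sym (take-map {f = g} 1 z₂))
         (All.map⁺ (All.map f⇒g (All.map⁻ (subst (All _) (take-map {f = f} 1 z₂) v>)))))

Increasing : List ℕ → Set
Increasing = AllPairs _<_

lookup-< : ∀ {R : List ℕ} → Increasing R → ∀ {i j} → i Fin.< j → List.lookup R i < List.lookup R j
lookup-< (a ∷ h) {zero}  {suc j} _         = All.lookup a (∈-lookup j)
lookup-< (a ∷ h) {suc i} {suc j} (s≤s i<j) = lookup-< h i<j

lookup-<⁻ : ∀ {R : List ℕ} → Increasing R → ∀ {i j} → List.lookup R i < List.lookup R j → i Fin.< j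
lookup-<⁻ h {i} {j} lt with Fin.<-cmp i j
... | tri< i<j _ _  = i<j
... | tri≈ _ refl _ = ⊥-elim (<-irrefl refl lt)
... | tri> _ _ j<i  = ⊥-elim (<-asym lt (lookup-< h j<i))

lookup-inj : ∀ {R : List ℕ} → Increasing R → ∀ {i j} → List.lookup R i ≡ List.lookup R j → i ≡ j
lookup-inj h {i} {j} eq with Fin.<-cmp i j
... | tri< i<j _ _ = ⊥-elim (<-irrefl eq (lookup-< h i<j))
... | tri≈ _ i≡j _ = i≡j
... | tri> _ _ j<i = ⊥-elim (<-irrefl (sym eq) (lookup-< h j<i))

-- Standardisation: replacing each letter by its rank in `R` preserves and reflects the order, and
-- `Fix` sees nothing else.
count-noFix : ∀ {R} → Increasing R → Count (λ w → Enumerates (_∈ R) w × NoFix w) (d (length R))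
count-noFix {R} h = count-words (List.lookup R) (lookup-inj h) ∈-lookup
  (λ x∈ → Any.index x∈ , sym (AnyP.lookup-index x∈))
  (λ {π} _ nf → noFix-map (lookup-<⁻ h) (toList π) nf)
  (λ {π} _ nf → noFix-map (lookup-< h) (toList π) nf)
  (count-noFix-permutations (length R))

-- The pattern in terms of words

DecreasingAbove : ℕ → List ℕ → Set
DecreasingAbove m = AllPairs (λ y z → ¬ (m < y × y < z))

Avoiding : List ℕ → Set
Avoiding w = ∀ x → Fix w x → DecreasingAbove x w

all-word : ∀ {P : ℕ → Set} (v : Vec (Fin n) m) → (∀ t → P (toℕ (lookup v t))) → All P (word v)
all-word []      h = []
all-word (_ ∷ v) h = h zero ∷ all-word v (h ∘ suc)

all-word⁻ : ∀ {P : ℕ → Set} (v : Vec (Fin n) m) → All P (word v) → ∀ t → P (toℕ (lookup v t))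
all-word⁻ (_ ∷ v) (p ∷ h) zero    = p
all-word⁻ (_ ∷ v) (p ∷ h) (suc t) = all-word⁻ v h t

allPairs-word : ∀ {R : ℕ → ℕ → Set} (v : Vec (Fin n) m) →
  (∀ {s t} → s Fin.< t → R (toℕ (lookup v s)) (toℕ (lookup v t))) → AllPairs R (word v)
allPairs-word []      h = []
allPairs-word (_ ∷ v) h = all-word v (λ t → h {zero} {suc t} (s≤s z≤n))
                        ∷ allPairs-word v (λ s<t → h (s≤s s<t))

allPairs-word⁻ : ∀ {R : ℕ → ℕ → Set} (v : Vec (Fin n) m) → AllPairs R (word v) →
  ∀ {s t} → s Fin.< t → R (toℕ (lookup v s)) (toℕ (lookup v t))
allPairs-word⁻ (_ ∷ v) (a ∷ _) {zero}  {suc t} _         = all-word⁻ v a t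
allPairs-word⁻ (_ ∷ v) (_ ∷ h) {suc s} {suc t} (s≤s s<t) = allPairs-word⁻ v h s<t

avoids⇒avoiding : {π : Vec (Fin n) n} → Permutation π → Avoids pattern23-11 π → Avoiding (word π)
avoids⇒avoiding {π = π} U av _ fix with ∈-map⁻ toℕ (fix-∈ fix)
... | i , _ , refl = allPairs-word π λ {s} {t} s<t (x<y , y<z) → av
  ( i ∷ lookup π s ∷ lookup π t ∷ [] , s ∷ t ∷ []
  , occurrence (x<y ∷ y<z ∷ [-]) (s<t ∷ [-]) refl
      (Fin.toℕ-injective (trans (hat-successor U i) (fix⇒successor fix)) ∷ []))

avoiding⇒avoids : {π : Vec (Fin n) n} → Permutation π → Avoiding (word π) → Avoids pattern23-11 π
avoiding⇒avoids {π = π} U av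
  (x ∷ _ ∷ _ ∷ [] , s ∷ t ∷ [] , occurrence (x<y ∷ y<z ∷ _) (s<t ∷ _) refl (eq ∷ [])) =
  allPairs-word⁻ π
    (av _ (successor⇒fix (word-unique U) (word-∈ U x) (trans (sym (hat-successor U x)) (cong toℕ eq))))
    s<t (x<y , y<z)

count-avoiders : ∀ n → Count (λ w → Enumerates (_< n) w × Avoiding w) (length (avoiders n pattern23-11))
count-avoiders n = count-words toℕ Fin.toℕ-injective Fin.toℕ<n (λ x<n → fromℕ< x<n , Fin.toℕ-fromℕ< x<n)
  (λ U av → avoids⇒avoiding U av) (λ U av → avoiding⇒avoids U av)
  (count-filter (avoids? pattern23-11) (permutations-enumerates n))

-- Shuffles and interleavings

enumerates-⇔ : (∀ {x} → P x → Q x) → (∀ {x} → Q x → P x) → Enumerates P xs → Enumerates Q xs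
enumerates-⇔ to from e = enumerates (unique e) (to ∘ sound e) (complete e ∘ from)

allPairs-insert⁺ : ∀ {T : A → A → Set} xs → (∀ {y} → T x y) → (∀ {y} → T y x) →
  AllPairs T (xs ++ ys) → AllPairs T (xs ++ x ∷ ys)
allPairs-insert⁺ []       from to h       = All.tabulate (λ _ → from) ∷ h
allPairs-insert⁺ {T = T} (z ∷ xs) from to (a ∷ h) =
  All.tabulate (λ y∈ → [ (λ y≡x → subst (T z) (sym y≡x) to) , All.lookup a ]′ (∈-insert⁻ xs y∈)) ∷ allPairs-insert⁺ xs from to h

allPairs-insert⁻ : ∀ {T : A → A → Set} xs → AllPairs T (xs ++ x ∷ ys) → AllPairs T (xs ++ ys)
allPairs-insert⁻ []       (_ ∷ h) = h
allPairs-insert⁻ (z ∷ xs) (a ∷ h) =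
  All.tabulate (λ y∈ → All.lookup a (∈-insert⁺ xs y∈)) ∷ allPairs-insert⁻ xs h

insert-injective : ∀ (p p′ : List A) {q q′} → x ∉ p → x ∉ p′ → p ++ x ∷ q ≡ p′ ++ x ∷ q′ → p ≡ p′ × q ≡ q′
insert-injective []      []       _  _   refl = refl , refl
insert-injective []      (_ ∷ p′) _  x∉′ eq   = ⊥-elim (x∉′ (here (∷-injectiveˡ eq)))
insert-injective (_ ∷ p) []       x∉ _   eq   = ⊥-elim (x∉ (here (sym (∷-injectiveˡ eq))))
insert-injective (_ ∷ p) (_ ∷ p′) x∉ x∉′ eq with ∷-injective eq
... | refl , eq′ with insert-injective p p′ (x∉ ∘ there) (x∉′ ∘ there) eq′
... | refl , refl = refl , refl

count-splits : (w : List A) → Count {A = List A × List A} (λ (p , q) → p ++ q ≡ w) (suc (length w))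
count-splits []      = count-singleton ([] , []) refl λ { {[] , []} _ → refl }
count-splits (a ∷ w) = count-⇔
  (λ { (inj₁ refl) → refl ; (inj₂ (p , q , refl , refl)) → refl })
  (λ { {[] , _} refl → inj₁ refl ; {_ ∷ p , q} refl → inj₂ (p , q , refl , refl) })
  (count-⊎ {P = _≡ ([] , a ∷ w)} (λ { refl (_ , _ , () , _) })
    (count-singleton _ refl id)
    (count-image {Q = λ t → ∃₂ λ p q → t ≡ (a ∷ p , q) × p ++ q ≡ w}
      (λ (p , q) → a ∷ p , q) (count-splits w)
      (λ {(p , q)} eq → p , q , refl , eq)
      (λ { _ _ refl → refl })
      (λ { (p , q , refl , eq) → (p , q) , eq , refl })))

count-all-splits : {P : List A → Set} → Count P k → (∀ {w} → P w → length w ≡ l) →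
  Count {A = List A × List A} (λ (p , q) → P (p ++ q)) (k * suc l)
count-all-splits {P = P} c len = count-image proj₂
  (count-× {R = λ w (p , q) → p ++ q ≡ w} c
    (λ {w} Pw → count-cong (cong suc (len Pw)) (count-splits w)))
  (λ { (Pw , refl) → Pw })
  (λ { (_ , refl) (_ , refl) refl → refl })
  (λ {(p , q)} Pw → (p ++ q , p , q) , (Pw , refl) , refl)

-- The largest letter must come first, since any letter before it would form a rise above `m`.
-- Removing it leaves the same problem with one letter fewer.
count-decreasing : ∀ m l → Count (λ w → Enumerates (λ z → m < z × z < suc m + l) w × DecreasingAbove m w) 1
count-decreasing m zero = count-singleton []
  (enumerates [] (λ ()) (λ (m<z , z<) → ⊥-elim (empty m<z z<)) , [])
  (λ { {[]} _ → refl ; {z ∷ _} (e , _) → let m<z , z< = sound e (here refl) in ⊥-elim (empty m<z z<) })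
  where
  empty : ∀ {z} → m < z → z < suc m + 0 → _
  empty {z} m<z z< = <⇒≱ z< (subst (_≤ z) (sym (+-identityʳ (suc m))) m<z)
count-decreasing m (suc l) = count-image (T ∷_) (count-decreasing m l) to (λ { _ _ refl → refl }) from
  where
  T = suc m + l

  T< : T < suc m + suc l
  T< = ≤-reflexive (sym (+-suc (suc m) l))

  ≤T : ∀ {z} → z < suc m + suc l → z ≤ T
  ≤T {z} z< = s≤s⁻¹ (subst (z <_) (+-suc (suc m) l) z<)

  to : ∀ {w} → Enumerates (λ z → m < z × z < T) w × DecreasingAbove m w →
       Enumerates (λ z → m < z × z < suc m + suc l) (T ∷ w) × DecreasingAbove m (T ∷ w)
  to (e , h) = enumerates
    (unique-∷ (λ T∈ → <-irrefl refl (proj₂ (sound e T∈))) (unique e))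
    (λ { (here refl) → m≤m+n (suc m) l , T<
       ; (there z∈)  → let m<z , z<T = sound e z∈ in m<z , <-trans z<T T< })
    (λ {z} (m<z , z<) → [ (λ z<T → there (complete e (m<z , z<T))) , here ]′ (m≤n⇒m<n∨m≡n (≤T z<)))
    , All.tabulate (λ z∈ (_ , T<z) → <-asym T<z (proj₂ (sound e z∈))) ∷ h

  from : ∀ {w} → Enumerates (λ z → m < z × z < suc m + suc l) w × DecreasingAbove m w →
    ∃ λ v → (Enumerates (λ z → m < z × z < T) v × DecreasingAbove m v) × T ∷ v ≡ w
  from {[]} (e , _) with complete e (m≤m+n (suc m) l , T<)
  ... | ()
  from {b ∷ w} (e , a ∷ h) with complete e (m≤m+n (suc m) l , T<) | sound e (here refl) | unique e
  ... | there T∈  | m<b , b< | u = ⊥-elim (All.lookup a T∈ (m<b , ≤∧≢⇒< (≤T b<)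
                                     λ { refl → proj₁ (unique-insert⁻ [] u) T∈ }))
  ... | here refl | _ | b≢ ∷ u = w , (enumerates u
    (λ z∈ → let m<z , z< = sound e (there z∈) in m<z , ≤∧≢⇒< (≤T z<) λ { refl → All.lookup b≢ z∈ refl })
    (λ (m<z , z<T) → tail-∈ z<T (complete e (m<z , <-trans z<T T<)))
    , h) , refl
    where
    tail-∈ : ∀ {z} → z < T → z ∈ T ∷ w → z ∈ w
    tail-∈ z<T (here refl) = ⊥-elim (<-irrefl refl z<T)
    tail-∈ z<T (there z∈)  = z∈

-- Falling factorials as binomial coefficients times factorials

[1+k]*[1+n]C[1+k]≡[1+n]*nCk : ∀ n k → suc k * (suc n C suc k) ≡ suc n * (n C k)
[1+k]*[1+n]C[1+k]≡[1+n]*nCk zero    zero    = refl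
[1+k]*[1+n]C[1+k]≡[1+n]*nCk zero    (suc k) = *-zeroʳ (suc (suc k))
[1+k]*[1+n]C[1+k]≡[1+n]*nCk (suc n) k = begin
  suc k * (suc (suc n) C suc k)
    ≡⟨ cong (suc k *_) (nCk+nC[k+1]≡[n+1]C[k+1] (suc n) k) ⟨
  suc k * (suc n C k + suc n C suc k)
    ≡⟨ *-distribˡ-+ (suc k) (suc n C k) _ ⟩
  suc k * (suc n C k) + suc k * (suc n C suc k)
    ≡⟨ cong (suc k * (suc n C k) +_) ([1+k]*[1+n]C[1+k]≡[1+n]*nCk n k) ⟩
  suc n C k + k * (suc n C k) + suc n * (n C k)
    ≡⟨ +-assoc (suc n C k) _ _ ⟩
  suc n C k + (k * (suc n C k) + suc n * (n C k))
    ≡⟨ cong (suc n C k +_) (absorb k) ⟩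
  suc n C k + suc n * (suc n C k) ∎
  where
  open ≡-Reasoning
  absorb : ∀ k → k * (suc n C k) + suc n * (n C k) ≡ suc n * (suc n C k)
  absorb zero    = refl
  absorb (suc k) = begin
    suc k * (suc n C suc k) + suc n * (n C suc k)
      ≡⟨ cong (_+ suc n * (n C suc k)) ([1+k]*[1+n]C[1+k]≡[1+n]*nCk n k) ⟩
    suc n * (n C k) + suc n * (n C suc k)
      ≡⟨ *-distribˡ-+ (suc n) (n C k) _ ⟨
    suc n * (n C k + n C suc k)
      ≡⟨ cong (suc n *_) (nCk+nC[k+1]≡[n+1]C[k+1] n k) ⟩
    suc n * (suc n C suc k) ∎

nCk*k!-suc : ∀ n r → (n C r) * r ! * suc n ≡ (suc n C suc r) * suc r !
nCk*k!-suc n r = rearrange (n C r) (suc n C suc r) (r !) ([1+k]*[1+n]C[1+k]≡[1+n]*nCk n r)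
  where
  rearrange : ∀ c c′ f → suc r * c′ ≡ suc n * c → c * f * suc n ≡ c′ * (suc r * f)
  rearrange c c′ f eq = begin
    c * f * suc n      ≡⟨ *-comm (c * f) (suc n) ⟩
    suc n * (c * f)    ≡⟨ *-assoc (suc n) c f ⟨
    suc n * c * f      ≡⟨ cong (_* f) eq ⟨
    suc r * c′ * f     ≡⟨ cong (_* f) (*-comm (suc r) c′) ⟩
    c′ * suc r * f     ≡⟨ *-assoc c′ (suc r) f ⟩
    c′ * (suc r * f)   ∎
    where open ≡-Reasoning

-- The factor `suc (r + l)` is the number of places for one more letter in a word of length `r + l`.
shuffles-suc : ∀ l r → ((l + r) C r) * r ! * suc (r + l) ≡ ((l + suc r) C suc r) * suc r !
shuffles-suc l r = trans
  (cong (λ s → ((l + r) C r) * r ! * suc s) (+-comm r l))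
  (trans (nCk*k!-suc (l + r) r) (cong (λ s → (s C suc r) * suc r !) (sym (+-suc l r))))

-- These are the candidates for `B` in `A m T B`. The bound `T` is strict because the letter `T`
-- itself stands before `B`.
Tail : ℕ → ℕ → List ℕ → List ℕ → Set
Tail m T S w = Enumerates (λ z → z ∈ S ⊎ (m < z × z < T)) w × DecreasingAbove m w

tail-length : ∀ {m l S w} → Unique S → All (_< m) S → Tail m (suc m + l) S w → length w ≡ length S + l
tail-length {m} {l} {S} u S< (e , _) = trans (enumerates-length e f)
  (trans (length-++ S) (cong (length S +_) (length-applyUpTo (suc m +_) l)))
  where
  f : Enumerates (λ z → z ∈ S ⊎ (m < z × z < suc m + l)) (S ++ applyUpTo (suc m +_) l)
  f = enumerates
    (Unique.++⁺ u (Unique.applyUpTo⁺₁ (suc m +_) l (λ i<j _ eq → <⇒≢ i<j (+-cancelˡ-≡ (suc m) _ _ eq)))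
      (λ (z∈ , z∈′) → let i , _ , eq = ∈-applyUpTo⁻ (suc m +_) z∈′ in
         <⇒≱ (All.lookup S< z∈) (subst (m ≤_) (sym eq) (≤-trans (n≤1+n m) (m≤m+n (suc m) i)))))
    (λ z∈ → [ inj₁ , (λ z∈′ → let i , i< , eq = ∈-applyUpTo⁻ (suc m +_) z∈′ in
         inj₂ (subst (m <_) (sym eq) (m≤m+n (suc m) i) , subst (_< suc m + l) (sym eq) (+-monoʳ-< (suc m) i<))) ]′ (∈-++⁻ S z∈))
    (λ { (inj₁ z∈) → ∈-++⁺ˡ z∈
       ; (inj₂ (m<z , z<)) → ∈-++⁺ʳ S (subst (_∈ _) (m+[n∸m]≡n m<z)
           (∈-applyUpTo⁺ (suc m +_) (+-cancelˡ-< (suc m) _ _ (subst (_< suc m + l) (sym (m+[n∸m]≡n m<z)) z<)))) })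

-- The letters of `S` are inserted one by one into the unique decreasing word. A letter below `m`
-- satisfies `DecreasingAbove m` with every other letter on either side, so each place is allowed;
-- the pairwise form of that condition makes this immediate.
count-tails : ∀ m l {S} → Unique S → All (_< m) S →
  Count (Tail m (suc m + l) S) (((l + length S) C length S) * length S !)
count-tails m l {[]} _ _ = count-⇔
  (λ (e , h) → enumerates-⇔ inj₂ [ (λ ()) , id ]′ e , h)
  (λ (e , h) → enumerates-⇔ [ (λ ()) , id ]′ inj₂ e , h)
  (count-decreasing m l)
count-tails m l {s ∷ S} (s≢ ∷ u) (s<m ∷ S<) = count-cong (shuffles-suc l (length S))
  (count-image (λ (p , q) → p ++ s ∷ q) (count-all-splits (count-tails m l u S<) (tail-length u S<))
    (λ {(p , q)} → to p q)
    (λ {(p , q)} {(p′ , q′)} t t′ eq → let a , b = insert-injective p p′ (s∉ p t) (s∉ p′ t′) eq in cong₂ _,_ a b)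
    from)
  where
  T = suc m + l

  s∉′ : ∀ {w} → Tail m T S w → s ∉ w
  s∉′ (e , _) s∈ with sound e s∈
  ... | inj₁ s∈S       = All.lookup s≢ s∈S refl
  ... | inj₂ (m<s , _) = <-asym m<s s<m

  s∉ : ∀ p {q} → Tail m T S (p ++ q) → s ∉ p
  s∉ p t = s∉′ t ∘ ∈-++⁺ˡ

  to : ∀ p q → Tail m T S (p ++ q) → Tail m T (s ∷ S) (p ++ s ∷ q)
  to p q t@(e , h) = enumerates
    (unique-insert⁺ p (s∉′ t) (unique e))
    (λ z∈ → [ inj₁ ∘ here , [ inj₁ ∘ there , inj₂ ]′ ∘ sound e ]′ (∈-insert⁻ p z∈))
    (λ { (inj₁ (here refl)) → ∈-++⁺ʳ p (here refl)
       ; (inj₁ (there z∈))  → ∈-insert⁺ p (complete e (inj₁ z∈))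
       ; (inj₂ z)           → ∈-insert⁺ p (complete e (inj₂ z)) })
    , allPairs-insert⁺ p (λ (m<s , _) → <-asym m<s s<m) (λ (m<y , y<s) → <-asym (<-trans m<y y<s) s<m) h

  from : ∀ {w} → Tail m T (s ∷ S) w → ∃ λ (p , q) → Tail m T S (p ++ q) × p ++ s ∷ q ≡ w
  from (e , h) with ∈-∃++ (complete e (inj₁ (here refl)))
  ... | p , q , refl with unique-insert⁻ p (unique e)
  ... | s∉w , u′ = (p , q) , (enumerates u′
    (λ z∈ → drop-s z∈ (sound e (∈-insert⁺ p z∈)))
    (λ z → [ (λ { refl → ⊥-elim (not-s z) }) , id ]′ (∈-insert⁻ p (complete e ([ inj₁ ∘ there , inj₂ ]′ z))))
    , allPairs-insert⁻ p h) , refl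
    where
    drop-s : ∀ {z} → z ∈ p ++ q → z ∈ s ∷ S ⊎ (m < z × z < T) → z ∈ S ⊎ (m < z × z < T)
    drop-s z∈ (inj₁ (here refl)) = ⊥-elim (s∉w z∈)
    drop-s z∈ (inj₁ (there z∈S)) = inj₁ z∈S
    drop-s z∈ (inj₂ z)           = inj₂ z
    not-s : ¬ (s ∈ S ⊎ (m < s × s < T))
    not-s (inj₁ s∈)        = All.lookup s≢ s∈ refl
    not-s (inj₂ (m<s , _)) = <-asym m<s s<m

-- Subsets and their complements as interleavings

interleaving-∈ : Interleaving S R U → x ∈ U → x ∈ S ⊎ x ∈ R
interleaving-∈ {S = S} i x∈ = ∈-++⁻ S (∈-resp-↭ (toPermutation i) x∈)

interleaving-allˡʳ : Interleaving S R U → All P U → All P S × All P R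
interleaving-allˡʳ []        []      = [] , []
interleaving-allˡʳ (consˡ i) (p ∷ h) = let a , b = interleaving-allˡʳ i h in p ∷ a , b
interleaving-allˡʳ (consʳ i) (p ∷ h) = let a , b = interleaving-allˡʳ i h in a , p ∷ b

interleaving-allPairsˡʳ : ∀ {T : A → A → Set} → Interleaving S R U → AllPairs T U → AllPairs T S × AllPairs T R
interleaving-allPairsˡʳ []        []      = [] , []
interleaving-allPairsˡʳ (consˡ i) (p ∷ h) =
  let a , b = interleaving-allPairsˡʳ i h in proj₁ (interleaving-allˡʳ i p) ∷ a , b
interleaving-allPairsˡʳ (consʳ i) (p ∷ h) =
  let a , b = interleaving-allPairsˡʳ i h in a , proj₂ (interleaving-allˡʳ i p) ∷ b

interleaving-disjoint : Interleaving S R U → Unique U → x ∈ S → x ∉ R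
interleaving-disjoint (consˡ i) (a ∷ u) (here refl) x∈R =
  All.lookup (proj₂ (interleaving-allˡʳ i a)) x∈R refl
interleaving-disjoint (consˡ i) (a ∷ u) (there x∈S) x∈R = interleaving-disjoint i u x∈S x∈R
interleaving-disjoint (consʳ i) (a ∷ u) x∈S (here refl) =
  All.lookup (proj₁ (interleaving-allˡʳ i a)) x∈S refl
interleaving-disjoint (consʳ i) (a ∷ u) x∈S (there x∈R) = interleaving-disjoint i u x∈S x∈R

∷-⊆⁻ : x ∉ xs → x ∷ xs ⊆ x ∷ ys → xs ⊆ ys
∷-⊆⁻ x∉ sub y∈ with sub (there y∈)
... | here refl = ⊥-elim (x∉ y∈)
... | there y∈′ = y∈′

-- The order inside `S` and `R` is inherited from `U`, so knowing `R` as a set is enough. This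
-- recovers both lists from the letters of `A`.
interleaving-unique : ∀ {S′ R′ : List A} → Interleaving S R U → Interleaving S′ R′ U → Unique U →
  R ⊆ R′ → R′ ⊆ R → S ≡ S′ × R ≡ R′
interleaving-unique []        []        _       _   _   = refl , refl
interleaving-unique (consˡ i) (consˡ j) (_ ∷ u) sub sup
  with refl , refl ← interleaving-unique i j u sub sup = refl , refl
interleaving-unique (consˡ i) (consʳ j) (a ∷ u) sub sup =
  ⊥-elim (All.lookup (proj₂ (interleaving-allˡʳ i a)) (sup (here refl)) refl)
interleaving-unique (consʳ i) (consˡ j) (a ∷ u) sub sup =
  ⊥-elim (All.lookup (proj₂ (interleaving-allˡʳ j a)) (sub (here refl)) refl)
interleaving-unique (consʳ i) (consʳ j) (a ∷ u) sub sup
  with refl , refl ← interleaving-unique i j u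
         (∷-⊆⁻ (λ x∈ → All.lookup (proj₂ (interleaving-allˡʳ i a)) x∈ refl) sub)
         (∷-⊆⁻ (λ x∈ → All.lookup (proj₂ (interleaving-allˡʳ j a)) x∈ refl) sup)
       = refl , refl

interleaving-by : (P? : Decidable P) → ∀ U → ∃₂ λ S R → Interleaving S R U × All (¬_ ∘ P) S × All P R
interleaving-by P? []      = [] , [] , [] , [] , []
interleaving-by P? (x ∷ U) with P? x | interleaving-by P? U
... | yes p | S , R , i , a , b = S , x ∷ R , consʳ i , a , p ∷ b
... | no ¬p | S , R , i , a , b = x ∷ S , R , consˡ i , ¬p ∷ a , b

-- For duplicate-free `U` such a pair is an `r`-element subset with its complement. Pascal's rule
-- splits by whether the first letter goes to `S` or to `R`.
count-interleavings : ∀ (U : List A) → Unique U → ∀ r →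
  Count {A = List A × List A} (λ (S , R) → Interleaving S R U × length S ≡ r) (length U C r)
count-interleavings [] _ zero = count-singleton ([] , []) ([] , refl) λ { ([] , _) → refl }
count-interleavings [] _ (suc r) = count-⊥ λ { ([] , ()) }
count-interleavings (u ∷ U) (_ ∷ uU) zero = count-image (λ (S , R) → S , u ∷ R) (count-interleavings U uU 0)
  (λ (i , eq) → consʳ i , eq) (λ { _ _ refl → refl })
  (λ { (consʳ i , eq) → -, (i , eq) , refl })
count-interleavings (u ∷ U) (a ∷ uU) (suc r) =
  count-cong (nCk+nC[k+1]≡[n+1]C[k+1] (length U) r)
    (count-⇔
      (λ { (inj₁ (_ , _ , refl , i , eq)) → consˡ i , cong suc eq
         ; (inj₂ (_ , _ , refl , i , eq)) → consʳ i , eq })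
      (λ { (consˡ i , eq) → inj₁ (_ , _ , refl , i , suc-injective eq)
         ; (consʳ i , eq) → inj₂ (_ , _ , refl , i , eq) })
      (count-⊎
        (λ { (_ , _ , refl , i , _) (_ , _ , refl , _) →
             All.lookup (proj₂ (interleaving-allˡʳ i a)) (here refl) refl })
        (count-image {Q = λ t → ∃₂ λ S R → t ≡ (u ∷ S , R) × Interleaving S R U × length S ≡ r}
          (λ (S , R) → u ∷ S , R) (count-interleavings U uU r)
          (λ (i , eq) → -, -, refl , i , eq) (λ { _ _ refl → refl })
          (λ { (_ , _ , refl , h) → -, h , refl }))
        (count-image {Q = λ t → ∃₂ λ S R → t ≡ (S , u ∷ R) × Interleaving S R U × length S ≡ suc r}
          (λ (S , R) → S , u ∷ R) (count-interleavings U uU (suc r))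
          (λ (i , eq) → -, -, refl , i , eq) (λ { _ _ refl → refl })
          (λ { (_ , _ , refl , h) → -, h , refl }))))

-- The smallest fixed point

allPairs-++⁻ʳ : ∀ {A : Set} {T : A → A → Set} xs {ys} → AllPairs T (xs ++ ys) → AllPairs T ys
allPairs-++⁻ʳ []       h       = h
allPairs-++⁻ʳ (_ ∷ xs) (_ ∷ h) = allPairs-++⁻ʳ xs h

LeastFix : List ℕ → ℕ → Set
LeastFix w m = Fix w m × (∀ {j} → j < m → ¬ Fix w j)

leastFix-unique : LeastFix w m → LeastFix w n → m ≡ n
leastFix-unique {m = m} {n} (f , l) (g , k) with <-cmp m n
... | tri< m<n _ _ = ⊥-elim (k m<n f)
... | tri≈ _ m≡n _ = m≡n
... | tri> _ _ n<m = ⊥-elim (l n<m g)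

fix? : Unique w → Decidable (Fix w)
fix? {w} U x = map′ (λ (x∈ , eq) → successor⇒fix U x∈ eq) (λ f → fix-∈ f , fix⇒successor f)
  (x ∈? w ×-dec successor 0 w x ≟ x)

leastFix? : Unique w → ∀ n → (∀ {j} → j < n → ¬ Fix w j) ⊎ (∃ λ m → m < n × LeastFix w m)
leastFix? U zero    = inj₁ λ ()
leastFix? U (suc n) with leastFix? U n
... | inj₂ (m , m<n , f) = inj₂ (m , m<n⇒m<1+n m<n , f)
... | inj₁ none with fix? U n
...   | yes f = inj₂ (n , n<1+n n , f , none)
...   | no ¬f = inj₁ λ j<1+n → [ none , (λ { refl → ¬f }) ]′ (m≤n⇒m<n∨m≡n (s≤s⁻¹ j<1+n))

-- Every fixed letter `x` is at least `m`, so a rise above `x` is also a rise above `m`.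
leastFix-avoiding : LeastFix w m → DecreasingAbove m w → Avoiding w
leastFix-avoiding (_ , least) h x f =
  AllPairs.map (λ ¬p (x<y , y<z) → ¬p (≤-<-trans (≮⇒≥ (λ x<m → least x<m f)) x<y , y<z)) h

-- A left-to-right maximum below `m` cannot come after `m`, so it lies in `A`. Conversely, in
-- `fix-extend`, a fixed letter that ends `A` stays fixed because the larger letter `m` follows it.
fix-prefix : ∀ A {m v j} → j < m → Fix (A ++ m ∷ v) j → Fix A j
fix-prefix A {m} {v} {j} j<m (u , v′ , eq , u< , v′>) = go A u (sym eq) u< v′>
  where
  go : ∀ A u {v′} → u ++ j ∷ v′ ≡ A ++ m ∷ v → All (_< j) u → All (j <_) (take 1 v′) → Fix A j
  go []      []      eq _ _ = ⊥-elim (<-irrefl (∷-injectiveˡ eq) j<m)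
  go []      (_ ∷ u) eq (u<j ∷ _) _ = ⊥-elim (<-asym j<m (subst (_< j) (∷-injectiveˡ eq) u<j))
  go (a ∷ []) [] refl _ _ = [] , [] , refl , [] , []
  go (a ∷ b ∷ A) [] refl _ (j<b ∷ _) = [] , b ∷ A , refl , [] , j<b ∷ []
  go (a ∷ A) (_ ∷ u) eq (u<j ∷ u<) v′> with ∷-injective eq
  ... | refl , eq′ with go A u eq′ u< v′>
  ... | u″ , v″ , eq″ , u″< , v″> = a ∷ u″ , v″ , cong (a ∷_) eq″ , u<j ∷ u″< , v″>

fix-extend : ∀ {A} → j < m → Fix A j → Fix (A ++ m ∷ v) j
fix-extend {j} {m} {v = v} j<m (u , v′ , refl , u< , v′>) =
  u , v′ ++ m ∷ v , ++-assoc u (j ∷ v′) (m ∷ v) , u< , head v′ v′>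
  where
  head : ∀ v′ → All (j <_) (take 1 v′) → All (j <_) (take 1 (v′ ++ m ∷ v))
  head []      _ = j<m ∷ []
  head (_ ∷ _) h = h

noFix-prefix⁺ : ∀ {A} → All (_< m) A → (∀ {j} → j < m → ¬ Fix (A ++ m ∷ v) j) → NoFix A
noFix-prefix⁺ A< none j f = none j<m (fix-extend j<m f)
  where j<m = All.lookup A< (fix-∈ f)

leastFix-∷ : ∀ {A} → All (_< m) A → All (m <_) (take 1 v) → NoFix A → LeastFix (A ++ m ∷ v) m
leastFix-∷ {v = v} {A = A} A< v> nf = (A , v , refl , A< , v>) , λ j<m f → nf _ (fix-prefix A j<m f)

count-top : ∀ T → Count (λ w → Enumerates (_< suc T) w × LeastFix w T) (d T)
count-top T = count-cong (cong d (length-upTo T))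
  (count-image (_∷ʳ T) (count-noFix (AllPairs.applyUpTo⁺₁ id T (λ i<j _ → i<j))) to
    (λ _ _ eq → ∷ʳ-injectiveˡ _ _ eq) from)
  where
  to : Enumerates (_∈ upTo T) w × NoFix w → Enumerates (_< suc T) (w ∷ʳ T) × LeastFix (w ∷ʳ T) T
  to {w} (e , nf) = enumerates
    (Unique.++⁺ (unique e) ([] ∷ []) λ { (z∈ , here refl) → <-irrefl refl (w< z∈) })
    (λ z∈ → [ m<n⇒m<1+n ∘ w< , (λ { (here refl) → n<1+n T }) ]′ (∈-++⁻ w z∈))
    (λ z<1+T → [ ∈-++⁺ˡ ∘ complete e ∘ ∈-upTo⁺ , (λ { refl → ∈-++⁺ʳ w (here refl) }) ]′
                 (m≤n⇒m<n∨m≡n (s≤s⁻¹ z<1+T)))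
    , leastFix-∷ (All.tabulate w<) [] nf
    where
    w< : ∀ {z} → z ∈ w → z < T
    w< = ∈-upTo⁻ ∘ sound e

  from : Enumerates (_< suc T) w × LeastFix w T → ∃ λ v → (Enumerates (_∈ upTo T) v × NoFix v) × v ∷ʳ T ≡ w
  -- A letter following a fixed letter is larger, and no letter exceeds `T`; hence `T` ends the
  -- word.
  from (e , (A , b ∷ v , refl , A< , T<b ∷ _) , _) =
    ⊥-elim (<⇒≱ T<b (s≤s⁻¹ (sound e (∈-++⁺ʳ A (there (here refl))))))
  from (e , (A , [] , refl , A< , _) , least) = A ,
    (enumerates (proj₁ (unique-++⁻ A (unique e)))
      (∈-upTo⁺ ∘ All.lookup A<)
      (λ z∈ → mem (∈-upTo⁻ z∈) (∈-++⁻ A (complete e (m<n⇒m<1+n (∈-upTo⁻ z∈)))))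
    , noFix-prefix⁺ A< least) , refl
    where
    mem : ∀ {z} → z < T → z ∈ A ⊎ z ∈ T ∷ [] → z ∈ A
    mem z<T (inj₁ z∈)          = z∈
    mem z<T (inj₂ (here refl)) = ⊥-elim (<-irrefl refl z<T)

-- The letters of the word A m T B are 0, …, T, and S and R are the sets of
-- letters below m that occur in B and in A.
Blocks : ℕ → ℕ → ℕ → (List ℕ × List ℕ) × (List ℕ × List ℕ) → Set
Blocks T m r ((S , R) , (A , B)) =
  (Interleaving S R (upTo m) × length S ≡ r) × ((Enumerates (_∈ R) A × NoFix A) × Tail m T S B)

increasing-upTo : ∀ n → Increasing (upTo n)
increasing-upTo n = AllPairs.applyUpTo⁺₁ id n (λ i<j _ → i<j)

-- `l` is the number of letters strictly between `m` and `T`. The factors count the choices of `S`,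
-- of `A` and of `B`; the last two depend on `S` only through its size `r`.
count-blocks : ∀ m l r →
  Count (Blocks (suc m + l) m r) ((m C r) * (d (m ∸ r) * (((l + r) C r) * r !)))
count-blocks m l r =
  count-× (count-cong (cong (_C r) (length-upTo m)) (count-interleavings (upTo m) (Unique.upTo⁺ m) r))
    λ { {S , R} (i , refl) → count-×
          (count-cong (cong d (length-R i))
            (count-noFix (proj₂ (interleaving-allPairsˡʳ i (increasing-upTo m)))))
          (λ _ → count-tails m l
            (proj₁ (interleaving-allPairsˡʳ i (Unique.upTo⁺ m)))
            (proj₁ (interleaving-allˡʳ i (All.all-upTo m)))) }
  where
  length-R : ∀ {S R} → Interleaving S R (upTo m) → length R ≡ m ∸ length S
  length-R {S} {R} i = begin
    length R                         ≡⟨ m+n∸m≡n (length S) (length R) ⟨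
    length S + length R ∸ length S   ≡⟨ cong (_∸ length S) (length-++ S) ⟨
    length (S ++ R) ∸ length S       ≡⟨ cong (_∸ length S) (↭-length (toPermutation i)) ⟨
    length (upTo m) ∸ length S       ≡⟨ cong (_∸ length S) (length-upTo m) ⟩
    m ∸ length S                     ∎
    where open ≡-Reasoning

rearrange : ∀ a b f e → a * (e * (b * f)) ≡ a * b * f * e
rearrange a b f e = begin
  a * (e * (b * f))   ≡⟨ cong (a *_) (*-comm e (b * f)) ⟩
  a * (b * f * e)     ≡⟨ *-assoc a (b * f) e ⟨
  a * (b * f) * e     ≡⟨ cong (_* e) (*-assoc a b f) ⟨
  a * b * f * e       ∎
  where open ≡-Reasoning

-- With n as `suc (suc m + l)` and the one-based smallest fixed point as `suc m`, n - m is `suc l`,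
-- so the truncated subtractions lose nothing.
top∸ : ∀ m l r → suc (suc m + l) ∸ suc m + r ∸ 1 ≡ l + r
top∸ m l r = cong (λ k → k + r ∸ 1) (trans (cong (_∸ m) (sym (+-suc m l))) (m+n∸m≡n m (suc l)))

-- The words `A m T B`

module _ (T : ℕ) where

  -- The bounds follow the double sum: its outer index is `suc m`, so `m < T` gives the range from 1
  -- to `T`, and `r < suc m` the range from 0 to `m`.
  Decomposition : ℕ × ℕ × (List ℕ × List ℕ) × (List ℕ × List ℕ) → Set
  Decomposition (m , r , t) = m < T × r < suc m × Blocks T m r t

  count-decompositions : Count Decomposition
    (∑[ m from 1 to T ] (∑[ r from 0 to m ∸ 1 ]
      (((m ∸ 1) C r) * (((suc T ∸ m) + r ∸ 1) C r) * (r !) * d ((m ∸ 1) ∸ r))))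
  count-decompositions = count-Σ-< T λ {m} m<T → count-Σ-< (suc m) λ {r} _ → blocks m r m<T
    where
    blocks : ∀ m r → m < T →
      Count (Blocks T m r) ((m C r) * (((suc T ∸ suc m) + r ∸ 1) C r) * (r !) * d (m ∸ r))
    blocks m r m<T with m≤n⇒∃[o]m+o≡n m<T
    ... | l , refl = count-cong
      (trans (rearrange (m C r) ((l + r) C r) (r !) (d (m ∸ r)))
             (cong (λ k → (m C r) * (k C r) * r ! * d (m ∸ r)) (sym (top∸ m l r))))
      (count-blocks m l r)

  assemble : ℕ × ℕ × (List ℕ × List ℕ) × (List ℕ × List ℕ) → List ℕ
  assemble (m , r , (S , R) , (A , B)) = A ++ m ∷ T ∷ B

  LowAvoider : List ℕ → Set
  LowAvoider w = Enumerates (_< suc T) w × Avoiding w × ∃ λ m → m < T × LeastFix w m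

  prefix-< : ∀ {A} → Interleaving S R (upTo m) → Enumerates (_∈ R) A → All (_< m) A
  prefix-< i e = All.tabulate λ z∈ → All.lookup (proj₂ (interleaving-allˡʳ i (All.all-upTo _))) (sound e z∈)

  assemble-leastFix : ∀ t → Decomposition t → LeastFix (assemble t) (proj₁ t)
  assemble-leastFix _ (m<T , _ , (i , _) , (eA , nf) , _) =
    leastFix-∷ (prefix-< i eA) (m<T ∷ []) nf

  assemble-sound : ∀ t → Decomposition t → LowAvoider (assemble t)
  assemble-sound t@(m , r , (S , R) , (A , B)) D@(m<T , _ , (i , _) , (eA , nf) , (eB , hB)) =
    enumerates uniq snd cmp ,
    leastFix-avoiding (assemble-leastFix t D) dec ,
    m , m<T , assemble-leastFix t D
    where
    A<m : All (_< m) A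
    A<m = prefix-< i eA

    S<m : All (_< m) S
    S<m = proj₁ (interleaving-allˡʳ i (All.all-upTo m))

    B-≢m,T : ∀ {z} → z ∈ B → z ≢ m × z < T
    B-≢m,T z∈ with sound eB z∈
    ... | inj₁ z∈S         = (λ { refl → <-irrefl refl (All.lookup S<m z∈S) }) , <-trans (All.lookup S<m z∈S) m<T
    ... | inj₂ (m<z , z<T) = (λ { refl → <-irrefl refl m<z }) , z<T

    A∩B : ∀ {z} → z ∈ A → z ∉ B
    A∩B z∈A z∈B with sound eB z∈B
    ... | inj₁ z∈S       = interleaving-disjoint i (Unique.upTo⁺ m) z∈S (sound eA z∈A)
    ... | inj₂ (m<z , _) = <-asym m<z (All.lookup A<m z∈A)

    uniq : Unique (A ++ m ∷ T ∷ B)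
    uniq = Unique.++⁺ (unique eA)
      (unique-∷ (λ { (here refl) → <-irrefl refl m<T ; (there m∈) → proj₁ (B-≢m,T m∈) refl })
        (unique-∷ (λ T∈ → <-irrefl refl (proj₂ (B-≢m,T T∈))) (unique eB)))
      (λ { (z∈ , here refl)         → <-irrefl refl (All.lookup A<m z∈)
         ; (z∈ , there (here refl)) → <-asym m<T (All.lookup A<m z∈)
         ; (z∈ , there (there z∈B)) → A∩B z∈ z∈B })

    snd : ∀ {z} → z ∈ A ++ m ∷ T ∷ B → z < suc T
    snd z∈ with ∈-++⁻ A z∈
    ... | inj₁ z∈A                 = <-trans (All.lookup A<m z∈A) (m<n⇒m<1+n m<T)
    ... | inj₂ (here refl)         = m<n⇒m<1+n m<T
    ... | inj₂ (there (here refl)) = n<1+n T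
    ... | inj₂ (there (there z∈B)) = m<n⇒m<1+n (proj₂ (B-≢m,T z∈B))

    cmp : ∀ {z} → z < suc T → z ∈ A ++ m ∷ T ∷ B
    cmp {z} z<1+T with <-cmp z m | m≤n⇒m<n∨m≡n (s≤s⁻¹ z<1+T)
    ... | tri≈ _ refl _ | _         = ∈-++⁺ʳ A (here refl)
    ... | tri> _ _ m<z  | inj₁ z<T  = ∈-++⁺ʳ A (there (there (complete eB (inj₂ (m<z , z<T)))))
    ... | tri> _ _ _    | inj₂ refl = ∈-++⁺ʳ A (there (here refl))
    ... | tri< z<m _ _  | _ with interleaving-∈ i (∈-upTo⁺ z<m)
    ...   | inj₁ z∈S = ∈-++⁺ʳ A (there (there (complete eB (inj₁ z∈S))))
    ...   | inj₂ z∈R = ∈-++⁺ˡ (complete eA z∈R)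

    ≤m-first : ∀ {y} v → y ≤ m → All (λ z → ¬ (m < y × y < z)) v
    ≤m-first v y≤m = All.tabulate λ _ (m<y , _) → <⇒≱ m<y y≤m

    low : ∀ A → All (_< m) A → DecreasingAbove m A
    low []      []      = []
    low (a ∷ A) (p ∷ h) = ≤m-first A (<⇒≤ p) ∷ low A h

    -- A rise above `m` cannot start in `A` or at `m`, whose letters are too small, nor at `T`,
    -- which is the largest; only pairs inside `B` remain.
    dec : DecreasingAbove m (A ++ m ∷ T ∷ B)
    dec = AllPairs.++⁺ (low A A<m)
      (≤m-first _ ≤-refl ∷ All.tabulate (λ z∈ (_ , T<z) → <-asym T<z (proj₂ (B-≢m,T z∈))) ∷ hB)
      (All.map (λ a<m → ≤m-first _ (<⇒≤ a<m)) A<m)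

  -- The word determines `m` as its smallest fixed letter, then `A` and `B` by cutting at `m`, then
  -- `R` as the set of letters of `A`, and with it `S` and its length `r`.
  assemble-injective : InjectiveOn Decomposition assemble
  assemble-injective {t@(m , r , (S , R) , (A , B))} {t′@(_ , r′ , (S′ , R′) , (A′ , B′))}
    D@(_ , _ , (i , refl) , (eA , _) , _) D′@(_ , _ , (i′ , refl) , (eA′ , _) , _) eq
    with refl ← leastFix-unique (assemble-leastFix t D)
           (subst (λ w → LeastFix w _) (sym eq) (assemble-leastFix t′ D′))
    with refl , refl ← insert-injective A A′
           (λ m∈ → <-irrefl refl (All.lookup (prefix-< i eA) m∈))
           (λ m∈ → <-irrefl refl (All.lookup (prefix-< i′ eA′) m∈)) eq
    with refl , refl ← interleaving-unique i i′ (Unique.upTo⁺ m)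
           (sound eA′ ∘ complete eA) (sound eA ∘ complete eA′) = refl

  -- T follows m immediately: otherwise the letter after m, which is larger
  -- than m, would precede the larger letter T.
  top-next : ∀ A {m v} → Enumerates (_< suc T) (A ++ m ∷ v) → m < T → All (_< m) A → All (m <_) (take 1 v) →
    DecreasingAbove m (A ++ m ∷ v) → ∃ λ B → v ≡ T ∷ B
  top-next A {m} {v} e m<T A< v> h with ∈-++⁻ A (complete e (n<1+n T))
  ... | inj₁ T∈         = ⊥-elim (<-asym m<T (All.lookup A< T∈))
  ... | inj₂ (here refl) = ⊥-elim (<-irrefl refl m<T)
  ... | inj₂ (there (here refl)) = -, refl
  top-next A {m} {b ∷ v} e m<T A< (m<b ∷ _) h | inj₂ (there (there T∈))
    with _ , (_ ∷ u) , _ ← unique-++⁻ A (unique e)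
    with b≢ ∷ _ ← u
    with (_ ∷ a ∷ _) ← allPairs-++⁻ʳ A h =
    ⊥-elim (All.lookup a T∈ (m<b , ≤∧≢⇒< (s≤s⁻¹ (sound e (∈-++⁺ʳ A (there (here refl))))) (All.lookup b≢ T∈)))

  decompose : ∀ {m A B S R} → Enumerates (_< suc T) (A ++ m ∷ T ∷ B) → DecreasingAbove m (A ++ m ∷ T ∷ B) →
    m < T → All (_< m) A → NoFix A → Interleaving S R (upTo m) → All (_∉ A) S → All (_∈ A) R →
    Decomposition (m , length S , (S , R) , (A , B))
  decompose {m} {A} {B} {S} {R} e h m<T A< nf i S∉A R∈A
    with uA , (m∉ ∷ (T∉ ∷ uB)) , A∩ ← unique-++⁻ A (unique e)
    with _ ∷ _ ∷ hB ← allPairs-++⁻ʳ A h =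
    m<T , s≤s length-S≤ , (i , refl) ,
    (enumerates uA A⊆R (All.lookup R∈A) , nf) ,
    (enumerates uB B-sound B-complete , hB)
    where
    length-S≤ : length S ≤ m
    length-S≤ = subst (length S ≤_) (trans (sym (length-++ S)) (trans (sym (↭-length (toPermutation i))) (length-upTo m)))
                  (m≤m+n (length S) (length R))

    A⊆R : ∀ {z} → z ∈ A → z ∈ R
    A⊆R z∈ with interleaving-∈ i (∈-upTo⁺ (All.lookup A< z∈))
    ... | inj₁ z∈S = ⊥-elim (All.lookup S∉A z∈S z∈)
    ... | inj₂ z∈R = z∈R

    B-sound : ∀ {z} → z ∈ B → z ∈ S ⊎ (m < z × z < T)
    B-sound {z} z∈ with <-cmp z m
    ... | tri≈ _ refl _ = ⊥-elim (All.lookup m∉ (there z∈) refl)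
    ... | tri> _ _ m<z  = inj₂ (m<z , ≤∧≢⇒< (s≤s⁻¹ (sound e (∈-++⁺ʳ A (there (there z∈))))) (All.lookup T∉ z∈ ∘ sym))
    ... | tri< z<m _ _ with interleaving-∈ i (∈-upTo⁺ z<m)
    ...   | inj₁ z∈S = inj₁ z∈S
    ...   | inj₂ z∈R = ⊥-elim (A∩ (All.lookup R∈A z∈R) (there (there z∈)))

    in-B : ∀ {z} → z ∉ A → z ≢ m → z < T → z ∈ B
    in-B z∉A z≢m z<T with ∈-++⁻ A (complete e (m<n⇒m<1+n z<T))
    ... | inj₁ z∈A                 = ⊥-elim (z∉A z∈A)
    ... | inj₂ (here z≡m)          = ⊥-elim (z≢m z≡m)
    ... | inj₂ (there (here refl)) = ⊥-elim (<-irrefl refl z<T)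
    ... | inj₂ (there (there z∈B)) = z∈B

    B-complete : ∀ {z} → z ∈ S ⊎ (m < z × z < T) → z ∈ B
    B-complete (inj₁ z∈S) = in-B (All.lookup S∉A z∈S) (<⇒≢ z<m) (<-trans z<m m<T)
      where z<m = All.lookup (proj₁ (interleaving-allˡʳ i (All.all-upTo m))) z∈S
    B-complete (inj₂ (m<z , z<T)) = in-B (λ z∈A → <-asym m<z (All.lookup A< z∈A)) (<⇒≢ m<z ∘ sym) z<T

  assemble-surjective : ∀ {w} → LowAvoider w → ∃ λ t → Decomposition t × assemble t ≡ w
  assemble-surjective (e , av , m , m<T , fix@(A , v , refl , A< , v>) , least)
    with B , refl ← top-next A e m<T A< v> (av m fix)
    -- The letters below `m` are sorted by whether they occur in `A`; those that do not must occur
    -- in `B`.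
    with S , R , i , S∉A , R∈A ← interleaving-by (_∈? A) (upTo m) =
    -, decompose e (av m fix) m<T A< (noFix-prefix⁺ A< least) i S∉A R∈A , refl

  count-lowAvoiders : Count LowAvoider
    (∑[ m from 1 to T ] (∑[ r from 0 to m ∸ 1 ]
      (((m ∸ 1) C r) * (((suc T ∸ m) + r ∸ 1) C r) * (r !) * d ((m ∸ 1) ∸ r))))
  count-lowAvoiders = count-image assemble count-decompositions
    (λ {t} → assemble-sound t) assemble-injective assemble-surjective

theorem5p5 : ∀ (n : ℕ) → 1 ≤ n →
    length (avoiders n pattern23-11)
    ≡ d n + d (n ∸ 1)
    + (∑[ m from 1 to n ∸ 1 ] (∑[ r from 0 to m ∸ 1 ]
    (((m ∸ 1) C r) * (((n ∸ m) + r ∸ 1) C r) * (r !) * d ((m ∸ 1) ∸ r))))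
theorem5p5 (suc T) _ = count-unique (count-avoiders (suc T))
  -- The nested disjoint unions match the three summands: no fixed letter, smallest fixed letter
  -- `T`, smallest fixed letter below `T`.
  (count-⇔ merge classify
    (count-⊎ (λ { (inj₁ (_ , nf)) (_ , _ , _ , _ , f , _) → nf _ f
                ; (inj₂ (_ , f)) (_ , _ , _ , m<T , g) → <-irrefl (leastFix-unique g f) m<T })
      (count-⊎ (λ (_ , nf) (_ , f , _) → nf _ f)
        (count-cong (cong d (length-upTo (suc T)))
          (count-⇔ (λ (e , nf) → enumerates-⇔ ∈-upTo⁻ ∈-upTo⁺ e , nf)
                   (λ (e , nf) → enumerates-⇔ ∈-upTo⁺ ∈-upTo⁻ e , nf)
            (count-noFix (increasing-upTo (suc T)))))
        (count-top T))
      (count-lowAvoiders T)))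
  where
  -- Avoidance is automatic in the first two classes, for want of a fixed letter or of a letter
  -- above `T`; only `LowAvoider` imposes it.
  Classes : List ℕ → Set
  Classes w = ((Enumerates (_< suc T) w × NoFix w) ⊎ (Enumerates (_< suc T) w × LeastFix w T)) ⊎ LowAvoider T w

  merge : ∀ {w} → Classes w → Enumerates (_< suc T) w × Avoiding w
  merge (inj₁ (inj₁ (e , nf))) = e , λ x f → ⊥-elim (nf x f)
  merge {w} (inj₁ (inj₂ (e , f)))  = e , leastFix-avoiding f (none-above w (sound e))
    where
    none-above : ∀ v → (∀ {z} → z ∈ v → z < suc T) → DecreasingAbove T v
    none-above []      _ = []
    none-above (a ∷ v) h = All.tabulate (λ _ (T<a , _) → <⇒≱ (h (here refl)) T<a) ∷ none-above v (h ∘ there)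
  merge (inj₂ (e , av , _))    = e , av

  classify : ∀ {w} → Enumerates (_< suc T) w × Avoiding w → Classes w
  classify (e , av) with leastFix? (unique e) (suc T)
  ... | inj₁ none = inj₁ (inj₁ (e , λ x f → none (sound e (fix-∈ f)) f))
  ... | inj₂ (m , m<1+T , f) with m≤n⇒m<n∨m≡n (s≤s⁻¹ m<1+T)
  ...   | inj₁ m<T  = inj₂ (e , av , m , m<T , f)
  ...   | inj₂ refl = inj₁ (inj₂ (e , f))
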